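{- Let $G_1=A_5\times\langle a\rangle$, $G_2=S_4$, $G_3=S_4\times\langle a\rangle$ with $|a|=2$, and for $n\ge3$ let $G_4=\langle r_0,r_1,r_2\mid r_0^2=r_1^2=r_2^2=1,\ (r_0r_1)^n=(r_1r_2)^2=(r_0r_2)^2=1\rangle\cong\mathbb Z_2\times D_{2n}$. If $\mathcal M$ is a regular linear hypermap on the sphere, then $\mathcal M$ is isomorphic to one of the following (with $\mathcal M$-sequences): $\mathcal M(G_1;(12)(35)a,(12)(34)a,(13)(24)a)$, $[0;2,5,3;30,12,20;120]$; $\mathcal M(G_1;(12)(35)a,(13)(24)a,(12)(34)a)$, $[0;2,3,5;30,20,12;120]$; $\mathcal M(G_1;(14)(35)a,(12)(45)a,(13)(45)a)$, $[0;3,2,5;20,30,12;120]$; $\mathcal M(G_1;(14)(35)a,(14)(23)a,(13)(45)a)$, $[0;5,2,3;12,30,20;120]$; $\mathcal M(G_2;(13),(12),(34))$, $[0;2,3,3;6,4,4;24]$; $\mathcal M(G_2;(34),(13),(12))$, $[0;3,2,3;4,6,4;24]$; $\mathcal M(G_3;(13),(34),(12)(34)a)$, $[0;2,4,3;12,6,8;48]$; $\mathcal M(G_3;(13),(12)(34)a,(34))$, $[0;2,3,4;12,8,6;48]$; $\mathcal M(G_3;(12)(34)a,(13),(12))$, $[0;3,2,4;8,12,6;48]$; $\mathcal M(G_3;(13)a,(12)a,(13)(24)a)$, $[0;4,2,3;6,12,8;48]$; $\mathcal M(G_4;r_0,r_1,r_2)$ for some $n\ge 3$, $[0;2,2,n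;n,n,2;4n]$.
   Context: $A_5$ and $S_4$ act on $\{1,\dots,5\}$ and $\{1,\dots,4\}$, elements in disjoint cycle notation; $a$ generates the direct factor of order 2; $D_{2n}$ is the dihedral group of order $2n$. For a finite group $G$ and pairwise distinct involutions $r_0,r_1,r_2$ generating $G$, $\mathcal M(G;r_0,r_1,r_2)$ is a regular linear hypermap if (1) $\langle r_1,r_2\rangle\cap\langle r_0,r_2\rangle=\langle r_2\rangle$ and (2) $\langle r_1,r_2\rangle\langle r_0,r_2\rangle\cap\langle r_0,r_2\rangle\langle r_1,r_2\rangle=\langle r_1,r_2\rangle\cup\langle r_0,r_2\rangle$. Flags are elements of $G$, $r_i$ acting by right multiplication; $\mathcal M(G;r_i)\cong\mathcal M(G';s_i)$ means a bijection $\sigma:G\to G'$ with $(xr_i)^\sigma=x^\sigma s_i$ for all $x,i$. $V=|G|/|\langle r_1,r_2\rangle|$, $E=|G|/|\langle r_0,r_2\rangle|$, $F=|G|/|\langle r_0,r_1\rangle|$ count vertices, hyperedges, hyperfaces; the type is $(k,m,n)=(|r_1r_2|,|r_0r_2|,|r_0r_1|)$. It is non-orientable if $G=\langle r_0r_2,r_1r_2\rangle$, orientable otherwise, with genus $g$ given by $V+E+F-|G|/2=2-2g$ (orientable) or $2-g$ (non-orientable); "on the sphere" means orientable of genus $0$. The $\mathcal M$-sequence is $[g;k,m,n;V,E,F;|G|]$. -}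

module Defs where

open import Level using (0ℓ)
open import Data.Nat using (ℕ; zero; suc; _+_; _*_; _∸_; _<_; _<ᵇ_; _<?_)
open import Data.Nat.DivMod using (_mod_)
open import Data.Bool using (Bool; true; false; _∧_; _∨_; not; if_then_else_; _xor_; T)
open import Data.Unit using (tt)
open import Data.Fin using (Fin; zero; suc; toℕ; fromℕ<; _≟_)
open import Data.Vec using (Vec; []; _∷_; tabulate; lookup; toList)
open import Data.List using (List; []; _∷_; length)
open import Data.Bool.ListAction using (any)
open import Data.List.Membership.Propositional using (_∈_)
open import Data.List.Relation.Unary.Unique.Propositional using (Unique)
open import Data.Product using (Σ; _×_; _,_; proj₁; proj₂; ∃; ∃₂)
open import Data.Sum using (_⊎_)
open import Function using (_∘_)
open import Function.Definitions using (Bijective)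
open import Relation.Nullary using (¬_)
open import Relation.Nullary.Decidable using (⌊_⌋; True; toWitness)
open import Relation.Binary.PropositionalEquality using (_≡_; _≢_)
open import Algebra.Core using (Op₁; Op₂)
open import Algebra.Structures using (IsGroup)

record FinGroup : Set₁ where
  infixl 7 _∙_
  field
    Carrier  : Set
    _∙_      : Op₂ Carrier
    ε        : Carrier
    _⁻¹      : Op₁ Carrier
    isGroup  : IsGroup _≡_ _∙_ ε _⁻¹
    elements : List Carrier
    elements-complete : ∀ x → x ∈ elements
    elements-unique   : Unique elements

  order : ℕ
  order = length elements


module _ (G : FinGroup) where
  open FinGroup G

  data ⟨_⟩ (S : List Carrier) : Carrier → Set where
    gen-ε   : ⟨ S ⟩ ε
    gen-∙   : ∀ {x s} → ⟨ S ⟩ x → s ∈ S → ⟨ S ⟩ (x ∙ s)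
    gen-∙⁻¹ : ∀ {x s} → ⟨ S ⟩ x → s ∈ S → ⟨ S ⟩ (x ∙ (s ⁻¹))

  _⊙_ : (Carrier → Set) → (Carrier → Set) → Carrier → Set
  (H ⊙ K) x = ∃₂ λ h k → H h × K k × x ≡ h ∙ k

  HasSize : (Carrier → Set) → ℕ → Set
  HasSize P n = Σ (List Carrier) λ l →
    Unique l × (∀ x → (x ∈ l → P x) × (P x → x ∈ l)) × length l ≡ n

  _^_ : Carrier → ℕ → Carrier
  x ^ zero  = ε
  x ^ suc j = x ∙ (x ^ j)

  HasOrder : Carrier → ℕ → Set
  HasOrder x k = 0 < k × x ^ k ≡ ε × (∀ j → 0 < j → j < k → x ^ j ≢ ε)

  IsInvolution : Carrier → Set
  IsInvolution x = x ∙ x ≡ ε × x ≢ ε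

  IsRegularLinearHypermap : Carrier → Carrier → Carrier → Set
  IsRegularLinearHypermap r₀ r₁ r₂ =
    IsInvolution r₀ × IsInvolution r₁ × IsInvolution r₂ ×
    r₀ ≢ r₁ × r₀ ≢ r₂ × r₁ ≢ r₂ ×
    (∀ x → ⟨ r₀ ∷ r₁ ∷ r₂ ∷ [] ⟩ x) ×
    (∀ x → ((⟨ r₁ ∷ r₂ ∷ [] ⟩ x × ⟨ r₀ ∷ r₂ ∷ [] ⟩ x) → ⟨ r₂ ∷ [] ⟩ x)
         × (⟨ r₂ ∷ [] ⟩ x → (⟨ r₁ ∷ r₂ ∷ [] ⟩ x × ⟨ r₀ ∷ r₂ ∷ [] ⟩ x))) ×
    (∀ x → (((⟨ r₁ ∷ r₂ ∷ [] ⟩ ⊙ ⟨ r₀ ∷ r₂ ∷ [] ⟩) x × (⟨ r₀ ∷ r₂ ∷ [] ⟩ ⊙ ⟨ r₁ ∷ r₂ ∷ [] ⟩) x)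
              → (⟨ r₁ ∷ r₂ ∷ [] ⟩ x ⊎ ⟨ r₀ ∷ r₂ ∷ [] ⟩ x))
         × ((⟨ r₁ ∷ r₂ ∷ [] ⟩ x ⊎ ⟨ r₀ ∷ r₂ ∷ [] ⟩ x)
              → ((⟨ r₁ ∷ r₂ ∷ [] ⟩ ⊙ ⟨ r₀ ∷ r₂ ∷ [] ⟩) x × (⟨ r₀ ∷ r₂ ∷ [] ⟩ ⊙ ⟨ r₁ ∷ r₂ ∷ [] ⟩) x)))

  Counts : Carrier → Carrier → Carrier → ℕ → ℕ → ℕ → Set
  Counts r₀ r₁ r₂ V E F =
    (Σ ℕ λ a → HasSize ⟨ r₁ ∷ r₂ ∷ [] ⟩ a × V * a ≡ order) ×
    (Σ ℕ λ b → HasSize ⟨ r₀ ∷ r₂ ∷ [] ⟩ b × E * b ≡ order) ×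
    (Σ ℕ λ c → HasSize ⟨ r₀ ∷ r₁ ∷ [] ⟩ c × F * c ≡ order)

  Orientable : Carrier → Carrier → Carrier → Set
  Orientable r₀ r₁ r₂ = ¬ (∀ x → ⟨ (r₀ ∙ r₂) ∷ (r₁ ∙ r₂) ∷ [] ⟩ x)

  -- orientable of genus g:  V + E + F - |G|/2 = 2 - 2g,
  -- written without subtraction/division as 2(V+E+F) + 4g = |G| + 4
  HasOrientableGenus : Carrier → Carrier → Carrier → ℕ → Set
  HasOrientableGenus r₀ r₁ r₂ g = Orientable r₀ r₁ r₂ ×
    (Σ ℕ λ V → Σ ℕ λ E → Σ ℕ λ F → Counts r₀ r₁ r₂ V E F ×
       2 * (V + E + F) + 4 * g ≡ order + 4)

  OnSphere : Carrier → Carrier → Carrier → Set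
  OnSphere r₀ r₁ r₂ = HasOrientableGenus r₀ r₁ r₂ 0

  -- M-sequence [g; k,m,n; V,E,F; |G|] (g = 0 is OnSphere, recorded separately)
  HasMSeq : Carrier → Carrier → Carrier → (k m n V E F N : ℕ) → Set
  HasMSeq r₀ r₁ r₂ k m n V E F N =
    HasOrder (r₁ ∙ r₂) k × HasOrder (r₀ ∙ r₂) m × HasOrder (r₀ ∙ r₁) n ×
    Counts r₀ r₁ r₂ V E F × order ≡ N

record Hypermap : Set₁ where
  field
    Flag : Set
    ρ₀ ρ₁ ρ₂ : Flag → Flag

𝓜 : (G : FinGroup) → FinGroup.Carrier G → FinGroup.Carrier G → FinGroup.Carrier G → Hypermap
𝓜 G r₀ r₁ r₂ = record
  { Flag = FinGroup.Carrier G ; ρ₀ = _∙ r₀ ; ρ₁ = _∙ r₁ ; ρ₂ = _∙ r₂ }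
  where open FinGroup G

_≅_ : Hypermap → Hypermap → Set
M ≅ M' = Σ (M.Flag → M'.Flag) λ σ → Bijective _≡_ _≡_ σ ×
  (∀ x → σ (M.ρ₀ x) ≡ M'.ρ₀ (σ x)) ×
  (∀ x → σ (M.ρ₁ x) ≡ M'.ρ₁ (σ x)) ×
  (∀ x → σ (M.ρ₂ x) ≡ M'.ρ₂ (σ x))
  where module M = Hypermap M
        module M' = Hypermap M'

-- Concrete permutations: a permutation of {1..k} is stored as the vector
-- of images of the points 1..k (point p is represented by Fin index p-1).

Perm : ℕ → Set
Perm k = Vec (Fin k) k

-- product: apply x first, then y
infixl 7 _·_
_·_ : ∀ {k} → Perm k → Perm k → Perm k
x · y = tabulate (λ i → lookup y (lookup x i))

τ : ∀ {k} (i j : ℕ) {i≤k : True ((i ∸ 1) <? k)} {j≤k : True ((j ∸ 1) <? k)} → Perm k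
τ i j {p} {q} = tabulate λ x →
  if ⌊ x ≟ a ⌋ then b else if ⌊ x ≟ b ⌋ then a else x
  where a = fromℕ< (toWitness p)
        b = fromℕ< (toWitness q)

allFinᵇ : ∀ k → (Fin k → Bool) → Bool
allFinᵇ zero    f = true
allFinᵇ (suc k) f = f zero ∧ allFinᵇ k (f ∘ suc)

isPerm : ∀ {k} → Perm k → Bool
isPerm {k} v = allFinᵇ k (λ j → any (λ x → ⌊ x ≟ j ⌋) (toList v))

private
  smaller : ℕ → List ℕ → ℕ
  smaller x []       = 0
  smaller x (y ∷ ys) = (if y <ᵇ x then 1 else 0) + smaller x ys

  inversions : List ℕ → ℕ
  inversions []       = 0
  inversions (x ∷ xs) = smaller x xs + inversions xs

  evenᵇ : ℕ → Bool
  evenᵇ zero    = true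
  evenᵇ (suc n) = not (evenᵇ n)

  toℕs : ∀ {k n} → Vec (Fin k) n → List ℕ
  toℕs []       = []
  toℕs (x ∷ xs) = toℕ x ∷ toℕs xs

isEvenPerm : ∀ {k} → Perm k → Bool
isEvenPerm v = isPerm v ∧ evenᵇ (inversions (toℕs v))

checkAll : ∀ n {k} → (Vec (Fin k) n → Bool) → Bool
checkAll zero    p = p []
checkAll (suc n) p = allFinᵇ _ (λ i → checkAll n (λ v → p (i ∷ v)))

private
  T∧ : ∀ a b → T (a ∧ b) → T a × T b
  T∧ true b h = tt , h

  allFinᵇ-sound : ∀ k f → T (allFinᵇ k f) → ∀ i → T (f i)
  allFinᵇ-sound (suc k) f h zero    = proj₁ (T∧ (f zero) _ h)
  allFinᵇ-sound (suc k) f h (suc i) = allFinᵇ-sound k (f ∘ suc) (proj₂ (T∧ (f zero) _ h)) i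

  checkAll-sound : ∀ n {k} (p : Vec (Fin k) n → Bool) → T (checkAll n p) → ∀ v → T (p v)
  checkAll-sound zero    p h [] = h
  checkAll-sound (suc n) p h (i ∷ v) =
    checkAll-sound n (λ w → p (i ∷ w)) (allFinᵇ-sound _ _ h i) v

  imp : ∀ a b → T (not a ∨ b) → T a → T b
  imp true b h _ = h

closedᵇ : ∀ {k} → (Perm k → Bool) → Perm k → Bool
closedᵇ {k} P s = checkAll k (λ v → not (P v) ∨ P (v · s))

SubPerm : ∀ k → (Perm k → Bool) → Set
SubPerm k P = Σ (Perm k) (T ∘ P)

rmul : ∀ {k} (P : Perm k → Bool) (s : Perm k) → T (closedᵇ P s) → SubPerm k P → SubPerm k P
rmul {k} P s c (v , pv) = v · s , imp (P v) _ (checkAll-sound k _ c v) pv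

PermMap : ∀ k (P : Perm k → Bool) (s₀ s₁ s₂ : Perm k)
  {c₀ : T (closedᵇ P s₀)} {c₁ : T (closedᵇ P s₁)} {c₂ : T (closedᵇ P s₂)} → Hypermap
PermMap k P s₀ s₁ s₂ {c₀} {c₁} {c₂} = record
  { Flag = SubPerm k P
  ; ρ₀ = rmul P s₀ c₀ ; ρ₁ = rmul P s₁ c₁ ; ρ₂ = rmul P s₂ c₂ }

-- M(H × ⟨a⟩; s₀,s₁,s₂); an element (v , b) stands for v aᵇ (b = true means "· a")
PermMap×C₂ : ∀ k (P : Perm k → Bool) (s₀ s₁ s₂ : Perm k × Bool)
  {c₀ : T (closedᵇ P (proj₁ s₀))} {c₁ : T (closedᵇ P (proj₁ s₁))} {c₂ : T (closedᵇ P (proj₁ s₂))}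
  → Hypermap
PermMap×C₂ k P s₀ s₁ s₂ {c₀} {c₁} {c₂} = record
  { Flag = SubPerm k P × Bool
  ; ρ₀ = λ { (v , b) → rmul P (proj₁ s₀) c₀ v , b xor proj₂ s₀ }
  ; ρ₁ = λ { (v , b) → rmul P (proj₁ s₁) c₁ v , b xor proj₂ s₁ }
  ; ρ₂ = λ { (v , b) → rmul P (proj₁ s₂) c₂ v , b xor proj₂ s₂ } }

M[G₁] : (s₀ s₁ s₂ : Perm 5 × Bool)
  {c₀ : T (closedᵇ isEvenPerm (proj₁ s₀))} {c₁ : T (closedᵇ isEvenPerm (proj₁ s₁))}
  {c₂ : T (closedᵇ isEvenPerm (proj₁ s₂))} → Hypermap
M[G₁] s₀ s₁ s₂ {c₀} {c₁} {c₂} = PermMap×C₂ 5 isEvenPerm s₀ s₁ s₂ {c₀} {c₁} {c₂}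

M[G₂] : (s₀ s₁ s₂ : Perm 4)
  {c₀ : T (closedᵇ isPerm s₀)} {c₁ : T (closedᵇ isPerm s₁)} {c₂ : T (closedᵇ isPerm s₂)} → Hypermap
M[G₂] s₀ s₁ s₂ {c₀} {c₁} {c₂} = PermMap 4 isPerm s₀ s₁ s₂ {c₀} {c₁} {c₂}

M[G₃] : (s₀ s₁ s₂ : Perm 4 × Bool)
  {c₀ : T (closedᵇ isPerm (proj₁ s₀))} {c₁ : T (closedᵇ isPerm (proj₁ s₁))}
  {c₂ : T (closedᵇ isPerm (proj₁ s₂))} → Hypermap
M[G₃] s₀ s₁ s₂ {c₀} {c₁} {c₂} = PermMap×C₂ 4 isPerm s₀ s₁ s₂ {c₀} {c₁} {c₂}

-- G₄ = ⟨r₀,r₁,r₂ | rᵢ² , (r₀r₁)ⁿ, (r₁r₂)², (r₀r₂)²⟩ ≅ D₂ₙ × ℤ₂, realised as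
-- pairs (φ , c) where φ(t) = ±t + k is an affine map of ℤₙ (encoded (f , k),
-- f = true meaning t ↦ -t + k), c ∈ ℤ₂, with product x·y = "x then y";
-- r₀ = (t ↦ -t , 0), r₁ = (t ↦ -t + 1 , 0), r₂ = (id , 1).

negₙ : ∀ {n} → Fin n → Fin n
negₙ {suc m} k = (suc m ∸ toℕ k) mod suc m

oneMinusₙ : ∀ {n} → Fin n → Fin n
oneMinusₙ {suc m} k = (suc (suc m) ∸ toℕ k) mod suc m

M[G₄] : ℕ → Hypermap
M[G₄] n = record
  { Flag = Bool × Fin n × Bool
  ; ρ₀ = λ { (f , k , c) → not f , negₙ k , c }
  ; ρ₁ = λ { (f , k , c) → not f , oneMinusₙ k , c }
  ; ρ₂ = λ { (f , k , c) → f , k , not c } }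

{-# OPTIONS --safe #-}
module Submission where

open import Defs
open import Algebra.Bundles using (Group)
open import Data.Bool using (Bool; true; false; _∧_; _∨_; not; if_then_else_; T)
open import Data.Bool.ListAction using (any; all)
open import Data.Bool.Properties using (T-∧; T-∨; T-irrelevant)
open import Data.Empty using (⊥; ⊥-elim)
open import Data.Fin using (Fin; zero; suc; toℕ; combine; punchOut)
open import Data.Fin.Patterns using (0F; 1F; 2F)
import Data.Fin.Properties as Finₚ
open import Data.List using (List; []; _∷_; _++_; length; lookup; map; filterᵇ; concatMap; allFin; applyUpTo; cartesianProduct; cartesianProductWith)
open import Data.List.Membership.Propositional using (_∈_; lose)
open import Data.List.Membership.Propositional.Properties
  using (∈-lookup; ∈-allFin; ∈-concatMap⁺; ∈-cartesianProduct⁺; ∈-cartesianProductWith⁺; ∈-applyUpTo⁺; ∈-applyUpTo⁻; ∈-++⁺ˡ; ∈-++⁺ʳ; ∈-++⁻)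
import Data.List.Properties as Listₚ
open import Data.List.Relation.Unary.All using (All; []; _∷_)
import Data.List.Relation.Unary.All as All
import Data.List.Relation.Unary.All.Properties as Allₚ
open import Data.List.Relation.Unary.AllPairs using (_∷_)
open import Data.List.Relation.Unary.Any using (here; there; index)
open import Data.List.Relation.Unary.Any.Properties using (any⁻; lookup-index)
open import Data.List.Relation.Unary.Unique.Propositional using (Unique)
import Data.List.Relation.Unary.Unique.Propositional.Properties as Uniqueₚ
open import Data.Nat using (ℕ; zero; suc; pred; _+_; _*_; _∸_; _≤_; _<_; _≡ᵇ_; _<ᵇ_; z≤n; s≤s; z<s; s<s; NonZero; >-nonZero)
open import Data.Nat.DivMod using (_%_; _/_; _mod_; m%n<n; m≡m%n+[m/n]*n)
import Data.Nat.Properties as ℕₚ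
open import Data.Nat.Tactic.RingSolver using (solve-∀)
open import Data.Product using (Σ; _×_; _,_; <_,_>; proj₁; proj₂; ∃)
open import Data.Sum as Sum using (_⊎_; inj₁; inj₂; [_,_]′)
open import Data.Unit using (tt)
open import Data.Vec using (Vec; []; _∷_)
open import Function using (_∘_; id; Equivalence; Inverse)
open import Function.Definitions using (Injective)
open import Relation.Binary.Definitions using (DecidableEquality)
open import Relation.Binary.PropositionalEquality using (_≡_; _≢_; refl; sym; trans; cong; cong₂; subst; module ≡-Reasoning)
open import Relation.Nullary using (¬_; Dec; yes; no; contradiction)
open import Relation.Nullary.Decidable using (does; map′)
open import Relation.Unary using (Decidable)

-- For involutions s ≠ t the subgroup ⟨s,t⟩ has twice as many elements as st has order, so on the sphere Euler's
-- formula becomes |G|(1/k + 1/m + 1/n − 1) = 4; condition (2) forces n ≥ 3, and the solutions are the listed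
-- M-sequences. Hence G is a quotient of the triangle group of type (k,m,n) and has the order of that
-- group, so it remains to see that the flags of each target map are presented by the Coxeter relations: then
-- x ↦ (a word leading to x, evaluated in G) is an equivariant map onto G between sets of equal size.
-- For the finite targets this is verified by evaluation. The words form a spanning tree of the flag graph, whose edges
-- hold by definition; every other edge closes a face around which the remaining edges are of lower rank or in
-- the tree, so it follows from the relation of that face.

-- Counting in finite sets, and bijectivity of equivariant maps.

lookup-injective : ∀ {A : Set} {xs : List A} → Unique xs → ∀ {i j} → lookup xs i ≡ lookup xs j → i ≡ j
lookup-injective (_ ∷ _)  {zero}  {zero}  _  = refl
lookup-injective (p ∷ _)  {zero}  {suc j} eq = contradiction eq (All.lookup p (∈-lookup j))
lookup-injective (p ∷ _)  {suc i} {zero}  eq = contradiction (sym eq) (All.lookup p (∈-lookup i))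
lookup-injective (_ ∷ u)  {suc i} {suc j} eq = cong suc (lookup-injective u eq)

index-injective : ∀ {A : Set} {xs : List A} {x y} (p : x ∈ xs) (q : y ∈ xs) → index p ≡ index q → x ≡ y
index-injective {xs = xs} p q eq =
  trans (lookup-index p) (trans (cong (lookup xs) eq) (sym (lookup-index q)))

Unique-⊆⇒length≤ : ∀ {A : Set} {xs ys : List A} → Unique xs → (∀ {x} → x ∈ xs → x ∈ ys) → length xs ≤ length ys
Unique-⊆⇒length≤ u sub = Finₚ.injective⇒≤
  λ {i} {j} eq → lookup-injective u (index-injective (sub (∈-lookup i)) (sub (∈-lookup j)) eq)

-- If `y` were missed, punching it out of the codomain would inject `Fin (suc n)` into `Fin n`.
Fin-injective⇒surjective : ∀ {m n} → m ≡ n → (f : Fin m → Fin n) → Injective _≡_ _≡_ f → ∀ y → ∃ λ x → f x ≡ y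
Fin-injective⇒surjective {suc n} refl f f-inj y with Finₚ.any? (λ x → f x Finₚ.≟ y)
... | yes hit = hit
... | no miss = contradiction (Finₚ.injective⇒≤ {f = g} (f-inj ∘ Finₚ.punchOut-injective (y≢f _) (y≢f _))) ℕₚ.1+n≰n
  where
  y≢f : ∀ x → y ≢ f x
  y≢f x eq = miss (x , sym eq)
  g : Fin (suc n) → Fin n
  g x = punchOut (y≢f x)

module FinGroupFacts (G : FinGroup) where
  open FinGroup G

  group : Group _ _
  group = record { isGroup = isGroup }
  open import Algebra.Properties.Group group using (inverseˡ-unique)

  involution⇒⁻¹ : ∀ {s} → s ∙ s ≡ ε → s ⁻¹ ≡ s
  involution⇒⁻¹ {s} s² = sym (inverseˡ-unique s s s²)

  position : Carrier → Fin order
  position x = index (elements-complete x)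

  position-injective : Injective _≡_ _≡_ position
  position-injective {x} {y} = index-injective (elements-complete x) (elements-complete y)

  -- Elements are compared through their positions in the enumeration. The search for a least
  -- exponent in `hasOrder` relies on this.
  _≟_ : DecidableEquality Carrier
  x ≟ y = map′ position-injective (cong position) (position x Finₚ.≟ position y)

  -- `Counts` merely asserts some size for each dihedral subgroup; this identifies it with the size
  -- computed from the order of a product of generators.
  HasSize-unique : ∀ {P m n} → HasSize G P m → HasSize G P n → m ≡ n
  HasSize-unique (xs , uxs , xs⇔P , refl) (ys , uys , ys⇔P , refl) = ℕₚ.≤-antisym
    (Unique-⊆⇒length≤ uxs λ {x} → proj₂ (ys⇔P x) ∘ proj₁ (xs⇔P x))
    (Unique-⊆⇒length≤ uys λ {x} → proj₂ (xs⇔P x) ∘ proj₁ (ys⇔P x))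

  module _ {r₀ r₁ r₂ : Carrier}
    (r₀² : r₀ ∙ r₀ ≡ ε) (r₁² : r₁ ∙ r₁ ≡ ε) (r₂² : r₂ ∙ r₂ ≡ ε)
    (generate : ∀ x → ⟨_⟩ G (r₀ ∷ r₁ ∷ r₂ ∷ []) x)
    (M : Hypermap) {N : ℕ} (code : Hypermap.Flag M → Fin N) (code-injective : Injective _≡_ _≡_ code)
    (order≡N : order ≡ N)
    where
    open Hypermap M

    -- An equivariant map onto G from at most |G| flags is a bijection, and its inverse is the isomorphism.
    equivariant⇒≅ : (φ : Flag → Carrier) → (∃ λ x → φ x ≡ ε) →
      (∀ x → φ x ∙ r₀ ≡ φ (ρ₀ x)) → (∀ x → φ x ∙ r₁ ≡ φ (ρ₁ x)) → (∀ x → φ x ∙ r₂ ≡ φ (ρ₂ x)) →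
      𝓜 G r₀ r₁ r₂ ≅ M
    equivariant⇒≅ φ (base , φbase) φ₀ φ₁ φ₂ =
      σ , (σ-injective , λ x → φ x , λ { refl → σφ x }) , equiv ρ₀ φ₀ , equiv ρ₁ φ₁ , equiv ρ₂ φ₂
      where
      Generator = _∈ (r₀ ∷ r₁ ∷ r₂ ∷ [])

      reach : ∀ {x s} → (∃ λ h → φ h ≡ x) → Generator s → ∃ λ h → φ h ≡ x ∙ s
      reach (h , refl) (here refl)                 = ρ₀ h , sym (φ₀ h)
      reach (h , refl) (there (here refl))         = ρ₁ h , sym (φ₁ h)
      reach (h , refl) (there (there (here refl))) = ρ₂ h , sym (φ₂ h)

      involutive : ∀ {s} → Generator s → s ⁻¹ ≡ s
      involutive (here refl)                 = involution⇒⁻¹ r₀²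
      involutive (there (here refl))         = involution⇒⁻¹ r₁²
      involutive (there (there (here refl))) = involution⇒⁻¹ r₂²

      onto : ∀ {x} → ⟨_⟩ G (r₀ ∷ r₁ ∷ r₂ ∷ []) x → ∃ λ h → φ h ≡ x
      onto gen-ε = base , φbase
      onto (gen-∙ p s∈) = reach (onto p) s∈
      onto (gen-∙⁻¹ {x} p s∈) rewrite involutive s∈ = reach (onto p) s∈

      σ : Carrier → Flag
      σ g = proj₁ (onto (generate g))

      φσ : ∀ g → φ (σ g) ≡ g
      φσ g = proj₂ (onto (generate g))

      σ-injective : Injective _≡_ _≡_ σ
      σ-injective {g} {h} eq = trans (sym (φσ g)) (trans (cong φ eq) (φσ h))

      f : Fin order → Fin N
      f = code ∘ σ ∘ lookup elements

      σφ : ∀ x → σ (φ x) ≡ x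
      -- Listing G and applying `σ` injects `Fin order` into `Fin N`. The sizes agree, so every flag
      -- is `σ g` for some `g`, and there `φσ` applies.
      σφ x with Fin-injective⇒surjective order≡N f
                  (lookup-injective elements-unique ∘ σ-injective ∘ code-injective) (code x)
      ... | i , eq with code-injective eq
      ...   | refl = cong σ (φσ _)

      equiv : ∀ {r} ρ → (∀ x → φ x ∙ r ≡ φ (ρ x)) → ∀ g → σ (g ∙ r) ≡ ρ (σ g)
      equiv {r} ρ φρ g = trans (cong σ (trans (cong (_∙ r) (sym (φσ g))) (φρ (σ g)))) (σφ (ρ (σ g)))

-- Presentations checked by evaluation

Word : Set
Word = List (Fin 3)

_≡ʷ_ : Word → Word → Bool
u ≡ʷ v = does (Listₚ.≡-dec Finₚ._≟_ u v)

alternate : ℕ → Fin 3 → Fin 3 → Word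
alternate zero    i j = []
alternate (suc e) i j = i ∷ j ∷ alternate e i j

-- (rᵢrⱼ)ᵉ = 1 solved for either generator: rᵢ = rⱼ(rᵢrⱼ)ᵉ⁻¹ and symmetrically.
braid : ℕ → Fin 3 → Fin 3 → List (Fin 3 × Word)
braid e i j = (i , j ∷ alternate (pred e) i j) ∷ (j , i ∷ alternate (pred e) j i) ∷ []

coxeter : ℕ → ℕ → ℕ → List (Fin 3 × Word)
coxeter k m n = braid k 1F 2F ++ braid m 0F 2F ++ braid n 0F 1F

findWord : List (ℕ × Word) → ℕ → Word
-- A flag missing from the table gets the empty word; the later check decides whether that is
-- acceptable.
findWord []            c = []
findWord ((d , w) ∷ t) c = if c ≡ᵇ d then w else findWord t c

fresh : List (ℕ × Word) → ℕ → Bool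
fresh t c = not (any (λ { (d , _) → c ≡ᵇ d }) t)

module _ (M : Hypermap) where
  open Hypermap M

  ρ : Fin 3 → Flag → Flag
  ρ 0F = ρ₀
  ρ 1F = ρ₁
  ρ 2F = ρ₂

  module _ (word : Flag → Word) where
    -- The induction measure for certifying edges. For words found by the search it is the sum of
    -- the depths of the two ends in the tree.
    rank : Flag → Fin 3 → ℕ
    rank x i = length (word x) + length (word (ρ i x))

    inTree : Flag → Fin 3 → Bool
    inTree x i = (word (ρ i x) ≡ʷ (i ∷ word x)) ∨ (word x ≡ʷ (i ∷ word (ρ i x)))

    -- Arrival is tested on words rather than flags: only the values of words in G matter
    -- afterwards, so flags need no decidable equality.
    walk : ℕ → Flag → Word → Flag → Bool
    walk b x []      y = word x ≡ʷ word y
    walk b x (i ∷ w) y = (inTree x i ∨ (rank x i <ᵇ b)) ∧ walk b (ρ i x) w y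

    certifyBy : Flag → Fin 3 → Fin 3 × Word → Bool
    certifyBy x i (j , w) = does (j Finₚ.≟ i) ∧ walk (rank x i) x w (ρ i x)

    certifyEdge : List (Fin 3 × Word) → Flag → Fin 3 → Bool
    certifyEdge rels x i = inTree x i ∨ any (certifyBy x i) rels

    certify : List (Fin 3 × Word) → List Flag → Bool
    certify rels = all λ x → all (certifyEdge rels x) (allFin 3)

  module _ (code : Flag → ℕ) where
    neighbours : Flag × Word → List (Flag × Word)
    neighbours (x , w) = map (λ i → ρ i x , i ∷ w) (allFin 3)

    -- Nothing needs to be proved about this search: presents checks whatever words it returns.
    bfs : ℕ → List (ℕ × Word) → List (Flag × Word) → List (ℕ × Word)
    bfs-next : ℕ → List (ℕ × Word) → List (Flag × Word) → List (Flag × Word) → List (ℕ × Word)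
    bfs zero    t q       = t
    bfs (suc n) t []      = t
    bfs (suc n) t (xw ∷ q) = bfs-next n t q (filterᵇ (λ { (y , _) → fresh t (code y) }) (neighbours xw))
    bfs-next n t q new = bfs n (t ++ map (λ { (y , w) → code y , w }) new) (q ++ new)

    presentsVia : List (ℕ × Word) → List (Fin 3 × Word) → Flag → List Flag → Bool
    presentsVia t rels x flags = (findWord t (code x) ≡ʷ []) ∧ certify (findWord t ∘ code) rels flags

    -- The table of words is an argument of presentsVia so that it is evaluated only once.
    presents : List (Fin 3 × Word) → List Flag → Bool
    -- Without flags there is no base point to map to `ε`.
    presents rels []              = false
    -- Each search step takes one flag off the queue, so the number of flags serves as fuel.
    presents rels flags@(x ∷ _) = presentsVia (bfs (length flags) ((code x , []) ∷ []) ((x , []) ∷ [])) rels x flags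

vecs : ∀ k n → List (Vec (Fin k) n)
vecs k zero    = [] ∷ []
vecs k (suc n) = cartesianProductWith _∷_ (allFin k) (vecs k n)

module _ {A : Set} (P : A → Bool) where
  -- The value `b` and its equation are separate arguments, so that one can split on `b` and still
  -- keep a proof about `P x`.
  attach : ∀ x b → P x ≡ b → List (Σ A (T ∘ P))
  attach x true  eq = (x , subst T (sym eq) _) ∷ []
  attach x false eq = []

  subtype : List A → List (Σ A (T ∘ P))
  subtype = concatMap λ x → attach x (P x) refl

-- The vector read in base `k`, lowest digit first: a numerical key for looking up words.
digits : ∀ {k n} → Vec (Fin k) n → ℕ
digits []      = 0
digits {k} (i ∷ v) = toℕ i + k * digits v

permLabel : ∀ {d P} → SubPerm d P → ℕ
permLabel (v , _) = digits v

permLabel×C₂ : ∀ {d P} → SubPerm d P × Bool → ℕ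
permLabel×C₂ (v , b) = (if b then 1 else 0) + 2 * permLabel v

permFlags : ∀ d (P : Perm d → Bool) → List (SubPerm d P)
permFlags d P = subtype P (vecs d d)

permFlags×C₂ : ∀ d (P : Perm d → Bool) → List (SubPerm d P × Bool)
permFlags×C₂ d P = cartesianProduct (permFlags d P) (false ∷ true ∷ [])

-- Completeness of the flag lists and soundness of the checks.

does-sound : ∀ {A : Set} (d : Dec A) → T (does d) → A
does-sound (yes a) _ = a

∈-vecs : ∀ {k n} (v : Vec (Fin k) n) → v ∈ vecs k n
∈-vecs []      = here refl
∈-vecs (i ∷ v) = ∈-cartesianProductWith⁺ _∷_ (∈-allFin i) (∈-vecs v)

module _ {A : Set} (P : A → Bool) where
  ∈-attach : ∀ x b (eq : P x ≡ b) (p : T (P x)) → (x , p) ∈ attach P x b eq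
  ∈-attach x true  eq p = here (cong (x ,_) (T-irrelevant p _))
  ∈-attach x false eq p with () ← subst T eq p

  ∈-subtype : ∀ {xs} → (∀ x → x ∈ xs) → ∀ x → x ∈ subtype P xs
  ∈-subtype complete (x , p) = ∈-concatMap⁺ _ (lose (complete x) (∈-attach x (P x) refl p))

≡ʷ-sound : ∀ u v → T (u ≡ʷ v) → u ≡ v
≡ʷ-sound u v = does-sound (Listₚ.≡-dec Finₚ._≟_ u v)

∧-sound : ∀ a {b} → T (a ∧ b) → T a × T b
∧-sound a = Equivalence.to (T-∧ {a})

∨-sound : ∀ a {b} → T (a ∨ b) → T a ⊎ T b
∨-sound a = Equivalence.to (T-∨ {a})

module Evaluation (G : FinGroup) (r : Fin 3 → FinGroup.Carrier G) where
  open FinGroup G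
  open FinGroupFacts G using (group)
  open Group group using (assoc; identityˡ; identityʳ)

  infixl 7 _▹_
  _▹_ : Carrier → Word → Carrier
  g ▹ []      = g
  g ▹ (i ∷ w) = g ∙ r i ▹ w

  ▹-assoc : ∀ g h w → g ∙ h ▹ w ≡ g ∙ (h ▹ w)
  ▹-assoc g h []      = refl
  ▹-assoc g h (i ∷ w) = trans (cong (_▹ w) (assoc g h (r i))) (▹-assoc g (h ∙ r i) w)

  -- Tree words are stored last letter first, unlike the relation words read by _▹_.
  ⟦_⟧ : Word → Carrier
  ⟦ [] ⟧    = ε
  ⟦ i ∷ w ⟧ = ⟦ w ⟧ ∙ r i

  Holds : Fin 3 × Word → Set
  Holds (i , w) = r i ≡ ε ▹ w

  -- Left translation carries a relation read at `ε` to any element `g`, that is, to the face at any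
  -- flag.
  Holds⇒▹ : ∀ {i w} → Holds (i , w) → ∀ g → g ∙ r i ≡ g ▹ w
  Holds⇒▹ {i} {w} h g = trans (cong (g ∙_) h)
    (trans (sym (▹-assoc g ε w)) (cong (_▹ w) (identityʳ g)))

  module Soundness (r² : ∀ i → r i ∙ r i ≡ ε) (M : Hypermap) (word : Hypermap.Flag M → Word)
    (rels : List (Fin 3 × Word)) (rels-hold : All Holds rels) where
    open Hypermap M using (Flag)

    φ : Flag → Carrier
    φ x = ⟦ word x ⟧

    Valid : Flag → Fin 3 → Set
    Valid x i = φ x ∙ r i ≡ φ (ρ M i x)

    -- Going away from the root this is the definition of `⟦_⟧`; going towards it, `r²` cancels the
    -- last letter.
    inTree-sound : ∀ x i → T (inTree M word x i) → Valid x i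
    inTree-sound x i t with ∨-sound (word (ρ M i x) ≡ʷ (i ∷ word x)) t
    ... | inj₁ down = cong ⟦_⟧ (sym (≡ʷ-sound (word (ρ M i x)) (i ∷ word x) down))
    ... | inj₂ up   = begin
      ⟦ word x ⟧ ∙ r i                    ≡⟨ cong (λ w → ⟦ w ⟧ ∙ r i) (≡ʷ-sound (word x) _ up) ⟩
      ⟦ word (ρ M i x) ⟧ ∙ r i ∙ r i      ≡⟨ assoc _ _ _ ⟩
      ⟦ word (ρ M i x) ⟧ ∙ (r i ∙ r i)    ≡⟨ cong (⟦ word (ρ M i x) ⟧ ∙_) (r² i) ⟩
      ⟦ word (ρ M i x) ⟧ ∙ ε              ≡⟨ identityʳ _ ⟩
      ⟦ word (ρ M i x) ⟧ ∎
      where open ≡-Reasoning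

    walk-sound : ∀ b → (∀ x i → rank M word x i < b → Valid x i) →
      ∀ x w y → T (walk M word b x w y) → φ x ▹ w ≡ φ y
    walk-sound b ih x []      y t = cong ⟦_⟧ (≡ʷ-sound (word x) (word y) t)
    walk-sound b ih x (i ∷ w) y t with ∧-sound (inTree M word x i ∨ _) t
    ... | step , rest = trans (cong (_▹ w) valid) (walk-sound b ih (ρ M i x) w y rest)
      where
      valid : Valid x i
      valid = [ inTree-sound x i , ih x i ∘ ℕₚ.<ᵇ⇒< _ _ ]′ (∨-sound (inTree M word x i) step)

    certifyEdge-sound : ∀ x i → (∀ y j → rank M word y j < rank M word x i → Valid y j) →
      T (certifyEdge M word rels x i) → Valid x i
    certifyEdge-sound x i ih t with ∨-sound (inTree M word x i) t
    ... | inj₁ tree = inTree-sound x i tree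
    ... | inj₂ face = All.lookupWith {Q = T ∘ certifyBy M word x i} {R = λ _ → Valid x i}
      (λ {jw} → use jw) rels-hold (any⁻ (certifyBy M word x i) rels face)
      where
      use : ∀ jw → Holds jw → T (certifyBy M word x i jw) → Valid x i
      use (j , w) h t with ∧-sound (does (j Finₚ.≟ i)) t
      ... | j≡i , walked with does-sound (j Finₚ.≟ i) j≡i
      -- The relation replaces the edge by the rest of the face, whose edges are already valid.
      ...   | refl = trans (Holds⇒▹ {w = w} h (φ x)) (walk-sound _ ih x w (ρ M i x) walked)

    certify-sound : ∀ {flags} → (∀ x → x ∈ flags) → T (certify M word rels flags) → ∀ x i → Valid x i
    certify-sound {flags} complete t x i = go _ x i (ℕₚ.n<1+n _)
      where
      edge : ∀ x i → T (certifyEdge M word rels x i)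
      edge x i = All.lookup (Allₚ.all⁺ (certifyEdge M word rels x) (allFin 3) edges-at-x) (∈-allFin i)
        where
        edges-at-x = All.lookup (Allₚ.all⁺ (λ y → all (certifyEdge M word rels y) (allFin 3)) flags t) (complete x)
      -- Strong induction on the rank, with a strict upper bound `b` as the recursive argument.
      go : ∀ b x i → rank M word x i < b → Valid x i
      go (suc b) x i (s≤s lt) = certifyEdge-sound x i (λ y j lt′ → go b y j (ℕₚ.<-≤-trans lt′ lt)) (edge x i)

-- Orders of elements and dihedral subgroups

least : ∀ {P : ℕ → Set} → Decidable P → ∀ n → P n → ∃ λ m → P m × (∀ j → j < m → ¬ P j)
least P? zero    p = 0 , p , λ _ ()
least P? (suc n) p with P? 0
... | yes p₀ = 0 , p₀ , λ _ ()
... | no ¬p₀ with least (P? ∘ suc) n p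
...   | m , pm , below = suc m , pm , λ { zero _ → ¬p₀ ; (suc j) (s<s lt) → below j lt }

module Powers (G : FinGroup) where
  open FinGroup G
  open FinGroupFacts G
  open Group group using (assoc; identityˡ; identityʳ)
  open import Algebra.Properties.Group group using (∙-cancelˡ; ∙-cancelʳ)
  open ≡-Reasoning

  infixr 8 _↑_
  _↑_ : Carrier → ℕ → Carrier
  _↑_ = _^_ G

  ↑-+ : ∀ x m n → x ↑ (m + n) ≡ x ↑ m ∙ x ↑ n
  ↑-+ x zero    n = sym (identityˡ _)
  ↑-+ x (suc m) n = trans (cong (x ∙_) (↑-+ x m n)) (sym (assoc x _ _))

  ↑-1 : ∀ x → x ↑ 1 ≡ x
  ↑-1 = identityʳ

  ↑-sucʳ : ∀ x n → x ↑ suc n ≡ x ↑ n ∙ x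
  ↑-sucʳ x n = trans (cong (x ↑_) (ℕₚ.+-comm 1 n)) (trans (↑-+ x n 1) (cong (x ↑ n ∙_) (↑-1 x)))

  ↑-*ε : ∀ {x k} → x ↑ k ≡ ε → ∀ q → x ↑ (q * k) ≡ ε
  ↑-*ε h zero    = refl
  ↑-*ε {x} {k} h (suc q) = trans (↑-+ x k (q * k)) (trans (cong₂ _∙_ h (↑-*ε {x} {k} h q)) (identityˡ ε))

  ↑-% : ∀ {x k} .{{_ : NonZero k}} → x ↑ k ≡ ε → ∀ j → x ↑ (j % k) ≡ x ↑ j
  ↑-% {x} {k} h j = sym (begin
    x ↑ j                           ≡⟨ cong (x ↑_) (m≡m%n+[m/n]*n j k) ⟩
    x ↑ (j % k + j / k * k)         ≡⟨ ↑-+ x (j % k) _ ⟩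
    x ↑ (j % k) ∙ x ↑ (j / k * k)   ≡⟨ cong (x ↑ (j % k) ∙_) (↑-*ε {x} {k} h (j / k)) ⟩
    x ↑ (j % k) ∙ ε                 ≡⟨ identityʳ _ ⟩
    x ↑ (j % k) ∎)

  ↑-∸ : ∀ x {i j} → i ≤ j → x ↑ i ≡ x ↑ j → x ↑ (j ∸ i) ≡ ε
  ↑-∸ x {i} {j} i≤j eq = ∙-cancelˡ (x ↑ i) _ _ (begin
    x ↑ i ∙ x ↑ (j ∸ i)  ≡⟨ ↑-+ x i _ ⟨
    x ↑ (i + (j ∸ i))    ≡⟨ cong (x ↑_) (ℕₚ.m+[n∸m]≡n i≤j) ⟩
    x ↑ j                ≡⟨ eq ⟨
    x ↑ i                ≡⟨ identityʳ _ ⟨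
    x ↑ i ∙ ε ∎)

  -- Among the powers with exponents 0 to |G| two coincide, and their quotient is a trivial power
  -- with positive exponent.
  hasOrder : ∀ x → ∃ (HasOrder G x)
  hasOrder x with Finₚ.pigeonhole (ℕₚ.n<1+n order) (λ i → position (x ↑ toℕ i))
  ... | i , j , i<j , eq
    -- The search runs over the predecessor of the exponent, which keeps the exponent found
    -- positive.
    with least (λ n → (x ↑ suc n) ≟ ε) (pred (toℕ j ∸ toℕ i))
           (subst (λ n → x ↑ n ≡ ε) (sym (ℕₚ.suc-pred (toℕ j ∸ toℕ i) {{>-nonZero (ℕₚ.m<n⇒0<n∸m i<j)}}))
             (↑-∸ x (ℕₚ.<⇒≤ i<j) (position-injective eq)))
  ... | k , zᵏ , below = suc k , z<s , zᵏ , λ { (suc j) _ (s<s lt) → below j lt }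

  HasOrder⇒injective : ∀ {x k} → HasOrder G x k → ∀ {i j} → i < j → j < k → x ↑ i ≢ x ↑ j
  HasOrder⇒injective {x} (_ , _ , minimal) {i} {j} i<j j<k eq =
    minimal (j ∸ i) (ℕₚ.m<n⇒0<n∸m i<j) (ℕₚ.≤-<-trans (ℕₚ.m∸n≤m j i) j<k) (↑-∸ x (ℕₚ.<⇒≤ i<j) eq)

  cancel-involution : ∀ {s} → s ∙ s ≡ ε → ∀ x → x ∙ s ∙ s ≡ x
  cancel-involution {s} s² x = trans (assoc x s s) (trans (cong (x ∙_) s²) (identityʳ x))

  generator : ∀ {S s} → s ∈ S → ⟨_⟩ G S s
  generator {S} {s} s∈ = subst (⟨_⟩ G S) (identityˡ s) (gen-∙ gen-ε s∈)

  module TwoInvolutions {s t : Carrier} (s² : s ∙ s ≡ ε) (t² : t ∙ t ≡ ε) where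
    z : Carrier
    z = s ∙ t

    z⁻¹ : z ∙ (t ∙ s) ≡ ε
    z⁻¹ = begin
      s ∙ t ∙ (t ∙ s)  ≡⟨ assoc _ t s ⟨
      s ∙ t ∙ t ∙ s    ≡⟨ cong (_∙ s) (cancel-involution t² s) ⟩
      s ∙ s            ≡⟨ s² ⟩
      ε ∎

    -- Both sides are the alternating word s t s ... s of length 2j + 1.
    z↑-flip : ∀ j → z ↑ j ∙ s ≡ s ∙ (t ∙ s) ↑ j
    z↑-flip zero    = trans (identityˡ s) (sym (identityʳ s))
    z↑-flip (suc j) = begin
      s ∙ t ∙ z ↑ j ∙ s            ≡⟨ assoc _ _ s ⟩
      s ∙ t ∙ (z ↑ j ∙ s)          ≡⟨ cong (s ∙ t ∙_) (z↑-flip j) ⟩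
      s ∙ t ∙ (s ∙ (t ∙ s) ↑ j)    ≡⟨ assoc s t _ ⟩
      s ∙ (t ∙ (s ∙ (t ∙ s) ↑ j))  ≡⟨ cong (s ∙_) (assoc t s _) ⟨
      s ∙ (t ∙ s ∙ (t ∙ s) ↑ j) ∎

    -- ts is the conjugate of st by s, so the two have the same trivial powers.
    swap-↑ε : ∀ {k} → z ↑ k ≡ ε → (t ∙ s) ↑ k ≡ ε
    swap-↑ε {k} h = ∙-cancelˡ s _ _ (begin
      s ∙ (t ∙ s) ↑ k  ≡⟨ z↑-flip k ⟨
      z ↑ k ∙ s        ≡⟨ cong (_∙ s) h ⟩
      ε ∙ s            ≡⟨ identityˡ s ⟩
      s                ≡⟨ identityʳ s ⟨
      s ∙ ε ∎)

    -- Both s and t(st)ᵉ are right inverses of s.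
    braid-relation : ∀ e → z ↑ suc e ≡ ε → s ≡ t ∙ z ↑ e
    braid-relation e h = ∙-cancelˡ s _ _ (trans s² (trans (sym h) (assoc s t _)))

    module _ (s≢ε : s ≢ ε) (t≢ε : t ≢ ε) where
      private
        pow-collapse : z ∙ z ≡ ε → ∀ m → z ↑ m ≡ ε ⊎ z ↑ m ≡ z
        pow-collapse z² zero    = inj₁ refl
        pow-collapse z² (suc m) with pow-collapse z² m
        ... | inj₁ eq = inj₂ (trans (cong (z ∙_) eq) (identityʳ z))
        ... | inj₂ eq = inj₁ (trans (cong (z ∙_) eq) z²)

      -- A reflection equal to a rotation commutes with z = st, which forces z² = ε.
      reflection≢rotation : ∀ m → s ≢ z ↑ m
      reflection≢rotation m eq with pow-collapse z² m
        where
        sz≡zs : s ∙ z ≡ z ∙ s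
        sz≡zs = begin
          s ∙ z       ≡⟨ cong (_∙ z) eq ⟩
          z ↑ m ∙ z   ≡⟨ ↑-sucʳ z m ⟨
          z ∙ z ↑ m   ≡⟨ cong (z ∙_) eq ⟨
          z ∙ s ∎
        z² : z ∙ z ≡ ε
        z² = begin
          z ∙ z            ≡⟨ assoc z s t ⟨
          z ∙ s ∙ t        ≡⟨ cong (_∙ t) sz≡zs ⟨
          s ∙ (s ∙ t) ∙ t  ≡⟨ cong (_∙ t) (assoc s s t) ⟨
          s ∙ s ∙ t ∙ t    ≡⟨ cancel-involution t² _ ⟩
          s ∙ s            ≡⟨ s² ⟩
          ε ∎
      ... | inj₁ zᵐ≡ε = s≢ε (trans eq zᵐ≡ε)
      ... | inj₂ zᵐ≡z = t≢ε (∙-cancelˡ s _ _ (trans (sym (trans eq zᵐ≡z)) (sym (identityʳ s))))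

      -- The elements are the k rotations `z ↑ j` and the k reflections `z ↑ j ∙ s` with j < k. The
      -- order of `z` separates them within each kind, and `reflection≢rotation` separates the
      -- kinds.
      dihedral-size : ∀ {k} → HasOrder G z k → HasSize G (⟨_⟩ G (s ∷ t ∷ [])) (2 * k)
      dihedral-size {k} ord@(k>0 , zᵏ , _) = rotations ++ reflections , unique , (λ x → sound x , complete) , size
        where
        H = ⟨_⟩ G (s ∷ t ∷ [])
        instance
          k≢0 : NonZero k
          k≢0 = >-nonZero k>0

        rotations reflections : List Carrier
        rotations   = applyUpTo (z ↑_) k
        reflections = applyUpTo (λ j → z ↑ j ∙ s) k

        size : length (rotations ++ reflections) ≡ 2 * k
        size = trans (Listₚ.length-++ rotations)
          (trans (cong₂ _+_ (Listₚ.length-applyUpTo (z ↑_) k) (Listₚ.length-applyUpTo (λ j → z ↑ j ∙ s) k))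
            (cong (k +_) (sym (ℕₚ.+-identityʳ k))))

        unique : Unique (rotations ++ reflections)
        unique = Uniqueₚ.++⁺
          (Uniqueₚ.applyUpTo⁺₁ _ k (HasOrder⇒injective ord))
          (Uniqueₚ.applyUpTo⁺₁ _ k λ i<j j<k → HasOrder⇒injective ord i<j j<k ∘ ∙-cancelʳ s _ _)
          disjoint
          where
          disjoint : ∀ {x} → ¬ (x ∈ rotations × x ∈ reflections)
          disjoint (x∈ , x∈′) with ∈-applyUpTo⁻ (z ↑_) x∈ | ∈-applyUpTo⁻ (λ j → z ↑ j ∙ s) x∈′
          -- Multiplying zⁱ = zʲs on the left by the inverse zᵏ⁻ʲ of zʲ would make s a rotation.
          ... | i , i<k , refl | j , j<k , eq = reflection≢rotation (k ∸ j + i) (begin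
            s                              ≡⟨ identityˡ s ⟨
            ε ∙ s                          ≡⟨ cong (_∙ s) zᵏ ⟨
            z ↑ k ∙ s                      ≡⟨ cong (λ n → z ↑ n ∙ s) (ℕₚ.m∸n+n≡m (ℕₚ.<⇒≤ j<k)) ⟨
            z ↑ (k ∸ j + j) ∙ s            ≡⟨ cong (_∙ s) (↑-+ z (k ∸ j) j) ⟩
            z ↑ (k ∸ j) ∙ z ↑ j ∙ s        ≡⟨ assoc _ _ s ⟩
            z ↑ (k ∸ j) ∙ (z ↑ j ∙ s)      ≡⟨ cong (z ↑ (k ∸ j) ∙_) eq ⟨
            z ↑ (k ∸ j) ∙ z ↑ i            ≡⟨ ↑-+ z (k ∸ j) i ⟨
            z ↑ (k ∸ j + i) ∎)

        rotation∈H : ∀ j → H (z ↑ j)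
        rotation∈H zero    = gen-ε
        rotation∈H (suc j) = subst H (trans (assoc _ s t) (sym (↑-sucʳ z j)))
          (gen-∙ (gen-∙ (rotation∈H j) (here refl)) (there (here refl)))

        sound : ∀ x → x ∈ rotations ++ reflections → H x
        sound x x∈ with ∈-++⁻ rotations x∈
        ... | inj₁ rot with ∈-applyUpTo⁻ (z ↑_) rot
        ...   | j , _ , refl = rotation∈H j
        sound x x∈ | inj₂ ref with ∈-applyUpTo⁻ (λ j → z ↑ j ∙ s) ref
        ...   | j , _ , refl = gen-∙ (rotation∈H j) (here refl)

        -- The exponent is unbounded here, so that products only add exponents; `complete` reduces
        -- it modulo `k` at the end.
        Dihedral : Carrier → Set
        Dihedral x = ∃ λ j → x ≡ z ↑ j ⊎ x ≡ z ↑ j ∙ s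

        -- The power zᵏ⁻¹ is the inverse ts of `z`, and tss = t.
        t-as-reflection : z ↑ pred k ∙ s ≡ t
        t-as-reflection = begin
          z ↑ pred k ∙ s    ≡⟨ cong (_∙ s) (∙-cancelˡ z _ _ (begin
            z ∙ z ↑ pred k    ≡⟨ cong (z ↑_) (ℕₚ.suc-pred k) ⟩
            z ↑ k             ≡⟨ zᵏ ⟩
            ε                 ≡⟨ z⁻¹ ⟨
            z ∙ (t ∙ s) ∎)) ⟩
          t ∙ s ∙ s         ≡⟨ cancel-involution s² t ⟩
          t ∎

        extend : ∀ {x g} → Dihedral x → g ∈ (s ∷ t ∷ []) → Dihedral (x ∙ g)
        extend (j , inj₁ refl) (here refl) = j , inj₂ refl
        extend (j , inj₂ refl) (here refl) = j , inj₁ (cancel-involution s² _)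
        extend (j , inj₁ refl) (there (here refl)) = j + pred k , inj₂ (begin
          z ↑ j ∙ t                    ≡⟨ cong (z ↑ j ∙_) t-as-reflection ⟨
          z ↑ j ∙ (z ↑ pred k ∙ s)     ≡⟨ assoc _ _ s ⟨
          z ↑ j ∙ z ↑ pred k ∙ s       ≡⟨ cong (_∙ s) (↑-+ z j (pred k)) ⟨
          z ↑ (j + pred k) ∙ s ∎)
        extend (j , inj₂ refl) (there (here refl)) = suc j , inj₁ (trans (assoc _ s t) (sym (↑-sucʳ z j)))

        dihedral : ∀ {x} → H x → Dihedral x
        dihedral gen-ε = 0 , inj₁ refl
        dihedral (gen-∙ p g∈) = extend (dihedral p) g∈
        dihedral (gen-∙⁻¹ p (here refl)) rewrite involution⇒⁻¹ s² = extend (dihedral p) (here refl)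
        dihedral (gen-∙⁻¹ p (there (here refl))) rewrite involution⇒⁻¹ t² = extend (dihedral p) (there (here refl))

        complete : ∀ {x} → H x → x ∈ rotations ++ reflections
        complete p with dihedral p
        ... | j , inj₁ refl = ∈-++⁺ˡ (subst (_∈ rotations) (↑-% zᵏ j) (∈-applyUpTo⁺ (z ↑_) (m%n<n j k)))
        ... | j , inj₂ refl = ∈-++⁺ʳ rotations (subst (λ y → y ∙ s ∈ reflections) (↑-% zᵏ j)
                                (∈-applyUpTo⁺ (λ j → z ↑ j ∙ s) (m%n<n j k)))

-- Spherical triples

-- The indices form the sequence without its genus. Constructors follow the order of the theorem and
-- are named after the solid with that symmetry group.
data Spherical : (k m n V E F N : ℕ) → Set where
  icosahedron₁ : Spherical 2 5 3 30 12 20 120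
  icosahedron₂ : Spherical 2 3 5 30 20 12 120
  icosahedron₃ : Spherical 3 2 5 20 30 12 120
  icosahedron₄ : Spherical 5 2 3 12 30 20 120
  tetrahedron₁ : Spherical 2 3 3 6 4 4 24
  tetrahedron₂ : Spherical 3 2 3 4 6 4 24
  octahedron₁  : Spherical 2 4 3 12 6 8 48
  octahedron₂  : Spherical 2 3 4 12 8 6 48
  octahedron₃  : Spherical 3 2 4 8 12 6 48
  octahedron₄  : Spherical 4 2 3 6 12 8 48
  hosohedron   : ∀ n → 3 ≤ n → Spherical 2 2 n n n 2 (4 * n)

-- The solutions of type (2,p,q) with p, q ≥ 3. `V` belongs to the exponent 2 and so counts the
-- edges of the solid.
data Platonic : (p q V E F N : ℕ) → Set where
  ⟨3,3⟩ : Platonic 3 3 6 4 4 24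
  ⟨3,4⟩ : Platonic 3 4 12 8 6 48
  ⟨4,3⟩ : Platonic 4 3 12 6 8 48
  ⟨3,5⟩ : Platonic 3 5 30 20 12 120
  ⟨5,3⟩ : Platonic 5 3 30 12 20 120

-- αu = βv = γw = 2c is a common multiple clearing the denominators of N/α + N/β + N/γ.
module _ (V E F α β γ : ℕ) {N} (euler : 2 * (V + E + F) ≡ N + 4)
  (u v w c : ℕ) (uα : α * u ≡ 2 * c) (vβ : β * v ≡ 2 * c) (wγ : γ * w ≡ 2 * c) where

  scaled-euler : V * α * u + E * β * v + F * γ * w ≡ c * (N + 4)
  scaled-euler = begin
    V * α * u + E * β * v + F * γ * w        ≡⟨ cong₂ _+_ (cong₂ _+_ (ℕₚ.*-assoc V α u) (ℕₚ.*-assoc E β v)) (ℕₚ.*-assoc F γ w) ⟩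
    V * (α * u) + E * (β * v) + F * (γ * w)  ≡⟨ cong₂ _+_ (cong₂ _+_ (cong (V *_) uα) (cong (E *_) vβ)) (cong (F *_) wγ) ⟩
    V * (2 * c) + E * (2 * c) + F * (2 * c)  ≡⟨ collect V E F c ⟩
    c * (2 * (V + E + F))                    ≡⟨ cong (c *_) euler ⟩
    c * (N + 4) ∎
    where
    open ≡-Reasoning
    collect : ∀ V E F c → V * (2 * c) + E * (2 * c) + F * (2 * c) ≡ c * (2 * (V + E + F))
    collect = solve-∀

  -- With α = 2k, β = 2m, γ = 2n, the condition on `c` says 1/k + 1/m + 1/n = 1, the Euclidean case.
  -- Then V + E + F ≤ N/2, against Euler's formula. Asking only for upper bounds on the products
  -- covers larger exponents too.
  not-spherical : .{{_ : NonZero c}} → u + v + w ≡ c → V * α ≤ N → E * β ≤ N → F * γ ≤ N → ⊥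
  not-spherical sum Vα≤N Eβ≤N Fγ≤N = ℕₚ.m+1+n≰m N (ℕₚ.*-cancelˡ-≤ c (begin
    c * (N + 4)                        ≡⟨ scaled-euler ⟨
    V * α * u + E * β * v + F * γ * w  ≤⟨ ℕₚ.+-mono-≤ (ℕₚ.+-mono-≤ (ℕₚ.*-monoˡ-≤ u Vα≤N) (ℕₚ.*-monoˡ-≤ v Eβ≤N)) (ℕₚ.*-monoˡ-≤ w Fγ≤N) ⟩
    N * u + N * v + N * w              ≡⟨ collect N u v w ⟩
    (u + v + w) * N                    ≡⟨ cong (_* N) sum ⟩
    c * N ∎))
    where
    open ℕₚ.≤-Reasoning
    collect : ∀ N u v w → N * u + N * v + N * w ≡ (u + v + w) * N
    collect = solve-∀

  -- Now 1/k + 1/m + 1/n = 1 + 1/c, so Euler's formula becomes (c + 1)N = c(N + 4).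
  spherical-order : u + v + w ≡ suc c → V * α ≡ N → E * β ≡ N → F * γ ≡ N → N ≡ c * 4
  spherical-order sum Vα≡N Eβ≡N Fγ≡N = ℕₚ.+-cancelˡ-≡ (c * N) _ _ (begin
    c * N + N                          ≡⟨ ℕₚ.+-comm (c * N) N ⟩
    suc c * N                          ≡⟨ cong (_* N) sum ⟨
    (u + v + w) * N                    ≡⟨ collect N u v w ⟩
    N * u + N * v + N * w              ≡⟨ cong₂ _+_ (cong₂ _+_ (cong (_* u) Vα≡N) (cong (_* v) Eβ≡N)) (cong (_* w) Fγ≡N) ⟨
    V * α * u + E * β * v + F * γ * w  ≡⟨ scaled-euler ⟩
    c * (N + 4)                        ≡⟨ ℕₚ.*-distribˡ-+ c N 4 ⟩
    c * N + c * 4 ∎)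
    where
    open ≡-Reasoning
    collect : ∀ N u v w → (u + v + w) * N ≡ N * u + N * v + N * w
    collect = solve-∀

-- Replaces a large exponent by the smaller one of a Euclidean triple, ready for `not-spherical`.
weaken : ∀ X {N} p q → p ≤ q → X * (2 * q) ≡ N → X * (2 * p) ≤ N
weaken X p q p≤q eq = ℕₚ.≤-trans (ℕₚ.*-monoʳ-≤ X (ℕₚ.*-monoʳ-≤ 2 p≤q)) (ℕₚ.≤-reflexive eq)

euler-swap : ∀ V E F {M} → 2 * (V + E + F) ≡ M → 2 * (V + F + E) ≡ M
euler-swap V E F eq = trans (shuffle V E F) eq
  where
  shuffle : ∀ V E F → 2 * (V + F + E) ≡ 2 * (V + E + F)
  shuffle = solve-∀

platonic-sym : ∀ {p q V E F N} → Platonic p q V E F N → Platonic q p V F E N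
platonic-sym ⟨3,3⟩ = ⟨3,3⟩
platonic-sym ⟨3,4⟩ = ⟨4,3⟩
platonic-sym ⟨4,3⟩ = ⟨3,4⟩
platonic-sym ⟨3,5⟩ = ⟨5,3⟩
platonic-sym ⟨5,3⟩ = ⟨3,5⟩

-- Once the order is known, each count is determined by cancelling its nonzero divisor.
solve₃ : ∀ {V E F N} V′ E′ F′ N′ {α β γ} .{{_ : NonZero α}} .{{_ : NonZero β}} .{{_ : NonZero γ}} (P : ℕ → ℕ → ℕ → ℕ → Set) →
  V′ * α ≡ N′ → E′ * β ≡ N′ → F′ * γ ≡ N′ →
  N ≡ N′ → V * α ≡ N → E * β ≡ N → F * γ ≡ N → P V′ E′ F′ N′ → P V E F N
solve₃ {V} {E} {F} V′ E′ F′ N′ {α} {β} {γ} P v′ e′ f′ refl v e f p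
  rewrite ℕₚ.*-cancelʳ-≡ V V′ α (trans v (sym v′))
        | ℕₚ.*-cancelʳ-≡ E E′ β (trans e (sym e′))
        | ℕₚ.*-cancelʳ-≡ F F′ γ (trans f (sym f′)) = p

platonic-triangle : ∀ q V E F {N} → 3 ≤ q →
  V * 4 ≡ N → E * 6 ≡ N → F * (2 * q) ≡ N → 2 * (V + E + F) ≡ N + 4 → Platonic 3 q V E F N
platonic-triangle 1 V E F (s≤s ()) v e f euler
platonic-triangle 2 V E F (s≤s (s≤s ())) v e f euler
-- The common multiple 2c of the three divisors is 12, 24, 60 for q = 3, 4, 5, so the order 4c is
-- 24, 48, 120.
platonic-triangle 3 V E F _ v e f euler =
  solve₃ 6 4 4 24 (Platonic 3 3) refl refl refl (spherical-order V E F 4 6 6 euler 3 2 2 6 refl refl refl refl v e f) v e f ⟨3,3⟩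
platonic-triangle 4 V E F _ v e f euler =
  solve₃ 12 8 6 48 (Platonic 3 4) refl refl refl (spherical-order V E F 4 6 8 euler 6 4 3 12 refl refl refl refl v e f) v e f ⟨3,4⟩
platonic-triangle 5 V E F _ v e f euler =
  solve₃ 30 20 12 120 (Platonic 3 5) refl refl refl (spherical-order V E F 4 6 10 euler 15 10 6 30 refl refl refl refl v e f) v e f ⟨3,5⟩
-- For q ≥ 6 the comparison is with the Euclidean triple (2,3,6).
platonic-triangle (q@(suc (suc (suc (suc (suc (suc _))))))) V E F _ v e f euler = contradiction
  (weaken F 6 q (ℕₚ.m≤m+n 6 _) f)
  (not-spherical V E F 4 6 12 euler 3 2 1 6 refl refl refl refl (ℕₚ.≤-reflexive v) (ℕₚ.≤-reflexive e))

platonic : ∀ p q V E F {N} → 3 ≤ p → 3 ≤ q →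
  V * 4 ≡ N → E * (2 * p) ≡ N → F * (2 * q) ≡ N → 2 * (V + E + F) ≡ N + 4 → Platonic p q V E F N
platonic 1 q V E F (s≤s ()) 3≤q v e f euler
platonic 2 q V E F (s≤s (s≤s ())) 3≤q v e f euler
platonic 3 q V E F _ 3≤q v e f euler = platonic-triangle q V E F 3≤q v e f euler
platonic (suc (suc (suc (suc _)))) 1 V E F _ (s≤s ()) v e f euler
platonic (suc (suc (suc (suc _)))) 2 V E F _ (s≤s (s≤s ())) v e f euler
platonic p@(suc (suc (suc (suc _)))) 3 V E F 3≤p _ v e f euler =
  platonic-sym (platonic-triangle p V F E 3≤p v f e (euler-swap V E F euler))
-- With both exponents at least 4 the comparison is with (2,4,4).
platonic p@(suc (suc (suc (suc _)))) q@(suc (suc (suc (suc _)))) V E F 3≤p 3≤q v e f euler = contradiction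
  (weaken F 4 q (ℕₚ.m≤m+n 4 _) f)
  (not-spherical V E F 4 8 8 euler 2 1 1 4 refl refl refl refl (ℕₚ.≤-reflexive v) (weaken E 4 p (ℕₚ.m≤m+n 4 _) e))

-- Equal divisors give E = V. Euler's formula then reads 2(2V + F) = 4V + 4, so F = 2, and counting
-- faces yields n = V.
hosohedral : ∀ n V E F {N} → 3 ≤ n →
  V * 4 ≡ N → E * 4 ≡ N → F * (2 * n) ≡ N → 2 * (V + E + F) ≡ N + 4 → Spherical 2 2 n V E F N
hosohedral n V E F 3≤n refl e f euler
  with ℕₚ.*-cancelʳ-≡ E V 4 e
... | refl with ℕₚ.*-cancelˡ-≡ F 2 2 (ℕₚ.+-cancelˡ-≡ (V * 4) _ _ (trans (expand V F) euler))
  where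
  expand : ∀ V F → V * 4 + 2 * F ≡ 2 * (V + V + F)
  expand = solve-∀
... | refl with ℕₚ.*-cancelʳ-≡ n V 4 (trans (regroup n) f)
  where
  regroup : ∀ n → n * 4 ≡ 2 * (2 * n)
  regroup = solve-∀
... | refl = subst (Spherical 2 2 V V V 2) (ℕₚ.*-comm 4 V) (hosohedron V 3≤n)

spherical : ∀ k m n V E F {N} → 2 ≤ k → 2 ≤ m → 3 ≤ n →
  V * (2 * k) ≡ N → E * (2 * m) ≡ N → F * (2 * n) ≡ N → 2 * (V + E + F) ≡ N + 4 → Spherical k m n V E F N
spherical 1 m n V E F (s≤s ())
spherical 2 1 n V E F _ (s≤s ())
spherical 2 2 n V E F _ _ 3≤n v e f euler = hosohedral n V E F 3≤n v e f euler
spherical 2 m@(suc (suc (suc _))) n V E F _ _ 3≤n v e f euler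
  with platonic m n V E F (s≤s (s≤s (s≤s z≤n))) 3≤n v e f euler
... | ⟨3,3⟩ = tetrahedron₁
... | ⟨3,4⟩ = octahedron₂
... | ⟨4,3⟩ = octahedron₁
... | ⟨3,5⟩ = icosahedron₂
... | ⟨5,3⟩ = icosahedron₁
spherical (suc (suc (suc _))) 1 n V E F _ (s≤s ())
-- The exponent 2 now belongs to the hyperedges, so `V` and `E` exchange roles.
spherical k@(suc (suc (suc _))) 2 n V E F {N} _ _ 3≤n v e f euler
  with platonic k n E V F (s≤s (s≤s (s≤s z≤n))) 3≤n e v f (subst (λ X → 2 * (X + F) ≡ N + 4) (ℕₚ.+-comm V E) euler)
... | ⟨3,3⟩ = tetrahedron₂
... | ⟨3,4⟩ = octahedron₃
... | ⟨4,3⟩ = octahedron₄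
... | ⟨3,5⟩ = icosahedron₃
... | ⟨5,3⟩ = icosahedron₄
-- With all exponents at least 3 the comparison is with (3,3,3).
spherical k@(suc (suc (suc _))) m@(suc (suc (suc _))) n V E F _ _ 3≤n v e f euler = contradiction
  (weaken F 3 n 3≤n f)
  (not-spherical V E F 6 6 6 euler 1 1 1 3 refl refl refl refl (weaken V 3 k (ℕₚ.m≤m+n 3 _) v) (weaken E 3 m (ℕₚ.m≤m+n 3 _) e))

-- Isomorphisms with the listed maps

module RegularHypermap (G : FinGroup) (r₀ r₁ r₂ : FinGroup.Carrier G)
  (r₀-inv : IsInvolution G r₀) (r₁-inv : IsInvolution G r₁) (r₂-inv : IsInvolution G r₂)
  (generate : ∀ x → ⟨_⟩ G (r₀ ∷ r₁ ∷ r₂ ∷ []) x) where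
  open FinGroup G
  open FinGroupFacts G
  open Powers G
  open Group group using (assoc; identityˡ; identityʳ)
  open import Algebra.Properties.Group group using (∙-cancelʳ)
  open ≡-Reasoning

  r₀² = proj₁ r₀-inv
  r₁² = proj₁ r₁-inv
  r₂² = proj₁ r₂-inv

  r : Fin 3 → Carrier
  r 0F = r₀
  r 1F = r₁
  r 2F = r₂

  r² : ∀ i → r i ∙ r i ≡ ε
  r² 0F = r₀²
  r² 1F = r₁²
  r² 2F = r₂²

  open Evaluation G r

  ▹-alternate : ∀ e i j g → g ▹ alternate e i j ≡ g ∙ (r i ∙ r j) ↑ e
  ▹-alternate zero    i j g = sym (identityʳ g)
  ▹-alternate (suc e) i j g = begin
    g ∙ r i ∙ r j ▹ alternate e i j         ≡⟨ ▹-alternate e i j _ ⟩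
    g ∙ r i ∙ r j ∙ (r i ∙ r j) ↑ e         ≡⟨ cong (_∙ (r i ∙ r j) ↑ e) (assoc g (r i) (r j)) ⟩
    g ∙ (r i ∙ r j) ∙ (r i ∙ r j) ↑ e       ≡⟨ assoc g _ _ ⟩
    g ∙ ((r i ∙ r j) ∙ (r i ∙ r j) ↑ e) ∎

  -- The second entry of `braid` needs the relation for rⱼrᵢ, which `swap-↑ε` supplies.
  braid-holds : ∀ {e} i j → HasOrder G (r i ∙ r j) e → All Holds (braid e i j)
  braid-holds {suc e} i j (_ , zᵉ , _) =
    one i j zᵉ ∷ one j i (TwoInvolutions.swap-↑ε (r² i) (r² j) {suc e} zᵉ) ∷ []
    where
    one : ∀ i j → (r i ∙ r j) ↑ suc e ≡ ε → Holds (i , j ∷ alternate e i j)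
    one i j h = begin
      r i                              ≡⟨ TwoInvolutions.braid-relation (r² i) (r² j) e h ⟩
      r j ∙ (r i ∙ r j) ↑ e            ≡⟨ cong (_∙ (r i ∙ r j) ↑ e) (identityˡ (r j)) ⟨
      ε ∙ r j ∙ (r i ∙ r j) ↑ e        ≡⟨ ▹-alternate e i j _ ⟨
      ε ∙ r j ▹ alternate e i j ∎

  module _ {k m n : ℕ} (ordₖ : HasOrder G (r₁ ∙ r₂) k) (ordₘ : HasOrder G (r₀ ∙ r₂) m)
    (ordₙ : HasOrder G (r₀ ∙ r₁) n) where

    coxeter-holds : All Holds (coxeter k m n)
    coxeter-holds = Allₚ.++⁺ (braid-holds 1F 2F ordₖ) (Allₚ.++⁺ (braid-holds 0F 2F ordₘ) (braid-holds 0F 1F ordₙ))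

    -- Two numberings are in play: `label` is the key of the word table, while the injective code
    -- that bounds the number of flags is the position in `flags`.
    presents⇒≅ : ∀ M (label : Hypermap.Flag M → ℕ) (flags : List (Hypermap.Flag M)) → (∀ x → x ∈ flags) →
      order ≡ length flags → T (presents M label (coxeter k m n) flags) → 𝓜 G r₀ r₁ r₂ ≅ M
    presents⇒≅ M label flags@(x ∷ xs) complete size t =
      equivariant⇒≅ r₀² r₁² r₂² generate M (index ∘ complete) (index-injective (complete _) (complete _)) size
        φ (x , cong ⟦_⟧ (≡ʷ-sound (word x) [] (proj₁ checks))) (λ y → valid y 0F) (λ y → valid y 1F) (λ y → valid y 2F)
      where
      word : Hypermap.Flag M → Word
      -- This is literally the table inside `presents`, so that `t` has the type of `checks` by
      -- computation.
      word = findWord (bfs M label (length flags) ((label x , []) ∷ []) ((x , []) ∷ [])) ∘ label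
      open Soundness r² M word (coxeter k m n) coxeter-holds
      checks : T (word x ≡ʷ []) × T (certify M word (coxeter k m n) flags)
      checks = ∧-sound (word x ≡ʷ []) t
      valid : ∀ y i → Valid y i
      valid = certify-sound complete (proj₂ checks)

    permMap-≅ : ∀ {d P} s₀ s₁ s₂ {c₀ c₁ c₂} (let M = PermMap d P s₀ s₁ s₂ {c₀} {c₁} {c₂}) →
      order ≡ length (permFlags d P) → T (presents M permLabel (coxeter k m n) (permFlags d P)) → 𝓜 G r₀ r₁ r₂ ≅ M
    permMap-≅ {d} {P} s₀ s₁ s₂ = presents⇒≅ _ permLabel (permFlags d P) (∈-subtype P ∈-vecs)

    permMap×C₂-≅ : ∀ {d P} s₀ s₁ s₂ {c₀ c₁ c₂} (let M = PermMap×C₂ d P s₀ s₁ s₂ {c₀} {c₁} {c₂}) →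
      order ≡ length (permFlags×C₂ d P) → T (presents M permLabel×C₂ (coxeter k m n) (permFlags×C₂ d P)) → 𝓜 G r₀ r₁ r₂ ≅ M
    permMap×C₂-≅ {d} {P} s₀ s₁ s₂ = presents⇒≅ _ permLabel×C₂ (permFlags×C₂ d P)
      λ { (v , b) → ∈-cartesianProduct⁺ (∈-subtype P ∈-vecs v) (∈-Bool b) }
      where
      ∈-Bool : ∀ b → b ∈ (false ∷ true ∷ [])
      ∈-Bool false = here refl
      ∈-Bool true  = there (here refl)

  -- As `n` varies, evaluation is replaced by a normal form: the flag (f,k,c) goes to r₀ᶠ(r₀r₁)ᵏr₂ᶜ.
  -- Here r₂ commutes with r₀ and r₁, and both of these invert r₀r₁.
  hosohedron-≅ : ∀ {n} → HasOrder G (r₁ ∙ r₂) 2 → HasOrder G (r₀ ∙ r₂) 2 → HasOrder G (r₀ ∙ r₁) n →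
    order ≡ 4 * n → 𝓜 G r₀ r₁ r₂ ≅ M[G₄] n
  hosohedron-≅ {n@(suc _)} (_ , r₁r₂-order , _) (_ , r₀r₂-order , _) (_ , zⁿ , _) size =
    equivariant⇒≅ r₀² r₁² r₂² generate (M[G₄] n) code code-injective (trans size (regroup n))
      φ ((false , zero , false) , trans (identityʳ _) (identityˡ _)) φ₀ φ₁ φ₂
    where
    regroup : ∀ n → 4 * n ≡ 2 * (n * 2)
    regroup = solve-∀

    bit : Bool → Fin 2
    bit = Inverse.from Finₚ.2↔Bool

    code : Bool × Fin n × Bool → Fin (2 * (n * 2))
    code (f , k , c) = combine (bit f) (combine k (bit c))

    bit-injective : ∀ {b c} → bit b ≡ bit c → b ≡ c
    bit-injective {false} {false} _ = refl
    bit-injective {true}  {true}  _ = refl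

    code-injective : ∀ {x y} → code x ≡ code y → x ≡ y
    code-injective {f , k , c} {f′ , k′ , c′} eq
      with f≡ , kc≡ ← Finₚ.combine-injective (bit f) _ (bit f′) _ eq
      with k≡ , c≡ ← Finₚ.combine-injective k _ k′ _ kc≡
      = cong₂ _,_ (bit-injective f≡) (cong₂ _,_ k≡ (bit-injective c≡))

    z : Carrier
    z = r₀ ∙ r₁

    infixr 8 _^ᵇ_
    _^ᵇ_ : Carrier → Bool → Carrier
    s ^ᵇ false = ε
    s ^ᵇ true  = s

    ^ᵇ-not : ∀ {s} → s ∙ s ≡ ε → ∀ b → s ^ᵇ b ∙ s ≡ s ^ᵇ not b
    ^ᵇ-not s² false = identityˡ _
    ^ᵇ-not s² true  = s²

    φ : Bool × Fin n × Bool → Carrier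
    φ (f , k , c) = r₀ ^ᵇ f ∙ z ↑ toℕ k ∙ r₂ ^ᵇ c

    commute : ∀ {s} → s ∙ s ≡ ε → (s ∙ r₂) ↑ 2 ≡ ε → ∀ c → r₂ ^ᵇ c ∙ s ≡ s ∙ r₂ ^ᵇ c
    commute {s} s² h false = trans (identityˡ s) (sym (identityʳ s))
    commute {s} s² h true = begin
      r₂ ∙ s                ≡⟨ cong (_∙ s) (TwoInvolutions.braid-relation r₂² s² 1 (TwoInvolutions.swap-↑ε s² r₂² {2} h)) ⟩
      s ∙ (r₂ ∙ s) ↑ 1 ∙ s  ≡⟨ cong (λ y → s ∙ y ∙ s) (↑-1 _) ⟩
      s ∙ (r₂ ∙ s) ∙ s      ≡⟨ cong (_∙ s) (assoc s r₂ s) ⟨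
      s ∙ r₂ ∙ s ∙ s        ≡⟨ cancel-involution s² _ ⟩
      s ∙ r₂ ∎

    -- Since r₁r₀ is the inverse of `z`, both sides are inverse to zʲ.
    z↑-inverse : ∀ i j → i + j ≡ n → z ↑ i ≡ (r₁ ∙ r₀) ↑ j
    z↑-inverse i j eq = ∙-cancelʳ (z ↑ j) _ _ (begin
      z ↑ i ∙ z ↑ j               ≡⟨ ↑-+ z i j ⟨
      z ↑ (i + j)                 ≡⟨ cong (z ↑_) eq ⟩
      z ↑ n                       ≡⟨ zⁿ ⟩
      ε                           ≡⟨ inverse j ⟨
      (r₁ ∙ r₀) ↑ j ∙ z ↑ j ∎)
      where
      inverse : ∀ j → (r₁ ∙ r₀) ↑ j ∙ z ↑ j ≡ ε
      inverse zero    = identityˡ ε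
      inverse (suc j) = begin
        (r₁ ∙ r₀) ↑ suc j ∙ (z ∙ z ↑ j)        ≡⟨ cong (_∙ (z ∙ z ↑ j)) (↑-sucʳ (r₁ ∙ r₀) j) ⟩
        (r₁ ∙ r₀) ↑ j ∙ (r₁ ∙ r₀) ∙ (z ∙ z ↑ j) ≡⟨ assoc _ z _ ⟨
        (r₁ ∙ r₀) ↑ j ∙ (r₁ ∙ r₀) ∙ z ∙ z ↑ j   ≡⟨ cong (_∙ z ↑ j) (assoc _ _ z) ⟩
        (r₁ ∙ r₀) ↑ j ∙ (r₁ ∙ r₀ ∙ z) ∙ z ↑ j   ≡⟨ cong (λ y → (r₁ ∙ r₀) ↑ j ∙ y ∙ z ↑ j) (TwoInvolutions.z⁻¹ r₁² r₀²) ⟩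
        (r₁ ∙ r₀) ↑ j ∙ ε ∙ z ↑ j               ≡⟨ cong (_∙ z ↑ j) (identityʳ _) ⟩
        (r₁ ∙ r₀) ↑ j ∙ z ↑ j                   ≡⟨ inverse j ⟩
        ε ∎

    z↑-mod : ∀ j → z ↑ toℕ (j mod n) ≡ z ↑ j
    z↑-mod j = trans (cong (z ↑_) (Finₚ.toℕ-fromℕ< (m%n<n j n))) (↑-% zⁿ j)

    flip₀ : ∀ k → z ↑ toℕ k ∙ r₀ ≡ r₀ ∙ z ↑ toℕ (negₙ k)
    flip₀ k = begin
      z ↑ toℕ k ∙ r₀              ≡⟨ TwoInvolutions.z↑-flip r₀² r₁² (toℕ k) ⟩
      r₀ ∙ (r₁ ∙ r₀) ↑ toℕ k      ≡⟨ cong (r₀ ∙_) (z↑-inverse (n ∸ toℕ k) (toℕ k) (ℕₚ.m∸n+n≡m (ℕₚ.<⇒≤ (Finₚ.toℕ<n k)))) ⟨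
      r₀ ∙ z ↑ (n ∸ toℕ k)        ≡⟨ cong (r₀ ∙_) (z↑-mod (n ∸ toℕ k)) ⟨
      r₀ ∙ z ↑ toℕ (negₙ k) ∎

    -- Writing r₁ = r₀z reduces this to `flip₀`; the additional factor `z` turns the exponent -k
    -- into 1 - k.
    flip₁ : ∀ k → z ↑ toℕ k ∙ r₁ ≡ r₀ ∙ z ↑ toℕ (oneMinusₙ k)
    flip₁ k = begin
      z ↑ toℕ k ∙ r₁                    ≡⟨ cong (_∙ r₁) (cancel-involution r₀² _) ⟨
      z ↑ toℕ k ∙ r₀ ∙ r₀ ∙ r₁          ≡⟨ assoc _ r₀ r₁ ⟩
      z ↑ toℕ k ∙ r₀ ∙ z                ≡⟨ cong (_∙ z) (flip₀ k) ⟩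
      r₀ ∙ z ↑ toℕ (negₙ k) ∙ z         ≡⟨ cong (λ y → r₀ ∙ y ∙ z) (z↑-mod (n ∸ toℕ k)) ⟩
      r₀ ∙ z ↑ (n ∸ toℕ k) ∙ z          ≡⟨ assoc r₀ _ z ⟩
      r₀ ∙ (z ↑ (n ∸ toℕ k) ∙ z)        ≡⟨ cong (r₀ ∙_) (↑-sucʳ z (n ∸ toℕ k)) ⟨
      r₀ ∙ z ↑ suc (n ∸ toℕ k)          ≡⟨ cong (λ j → r₀ ∙ z ↑ j) (ℕₚ.+-∸-assoc 1 (ℕₚ.<⇒≤ (Finₚ.toℕ<n k))) ⟨
      r₀ ∙ z ↑ (suc n ∸ toℕ k)          ≡⟨ cong (r₀ ∙_) (z↑-mod (suc n ∸ toℕ k)) ⟨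
      r₀ ∙ z ↑ toℕ (oneMinusₙ k) ∎

    -- The part common to r₀ and r₁: s passes r₂ᶜ by commutation and zᵏ by `flip`, and the r₀ this
    -- leaves is absorbed into r₀ᶠ.
    reflect : ∀ {s} k k′ → s ∙ s ≡ ε → (s ∙ r₂) ↑ 2 ≡ ε → z ↑ toℕ k ∙ s ≡ r₀ ∙ z ↑ toℕ k′ →
      ∀ f c → φ (f , k , c) ∙ s ≡ φ (not f , k′ , c)
    reflect {s} k k′ s² h flip f c = begin
      r₀ ^ᵇ f ∙ z ↑ toℕ k ∙ r₂ ^ᵇ c ∙ s      ≡⟨ assoc _ _ s ⟩
      r₀ ^ᵇ f ∙ z ↑ toℕ k ∙ (r₂ ^ᵇ c ∙ s)    ≡⟨ cong (r₀ ^ᵇ f ∙ z ↑ toℕ k ∙_) (commute s² h c) ⟩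
      r₀ ^ᵇ f ∙ z ↑ toℕ k ∙ (s ∙ r₂ ^ᵇ c)    ≡⟨ assoc _ s _ ⟨
      r₀ ^ᵇ f ∙ z ↑ toℕ k ∙ s ∙ r₂ ^ᵇ c      ≡⟨ cong (_∙ r₂ ^ᵇ c) (assoc _ _ s) ⟩
      r₀ ^ᵇ f ∙ (z ↑ toℕ k ∙ s) ∙ r₂ ^ᵇ c    ≡⟨ cong (λ y → r₀ ^ᵇ f ∙ y ∙ r₂ ^ᵇ c) flip ⟩
      r₀ ^ᵇ f ∙ (r₀ ∙ z ↑ toℕ k′) ∙ r₂ ^ᵇ c  ≡⟨ cong (_∙ r₂ ^ᵇ c) (assoc _ r₀ _) ⟨
      r₀ ^ᵇ f ∙ r₀ ∙ z ↑ toℕ k′ ∙ r₂ ^ᵇ c    ≡⟨ cong (λ y → y ∙ z ↑ toℕ k′ ∙ r₂ ^ᵇ c) (^ᵇ-not r₀² f) ⟩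
      r₀ ^ᵇ not f ∙ z ↑ toℕ k′ ∙ r₂ ^ᵇ c ∎

    φ₀ : ∀ x → φ x ∙ r₀ ≡ φ (Hypermap.ρ₀ (M[G₄] n) x)
    φ₀ (f , k , c) = reflect k (negₙ k) r₀² r₀r₂-order (flip₀ k) f c

    φ₁ : ∀ x → φ x ∙ r₁ ≡ φ (Hypermap.ρ₁ (M[G₄] n) x)
    φ₁ (f , k , c) = reflect k (oneMinusₙ k) r₁² r₁r₂-order (flip₁ k) f c

    φ₂ : ∀ x → φ x ∙ r₂ ≡ φ (Hypermap.ρ₂ (M[G₄] n) x)
    φ₂ (f , k , c) = trans (assoc _ _ r₂) (cong (r₀ ^ᵇ f ∙ z ↑ toℕ k ∙_) (^ᵇ-not r₂² c))

-- The type of a regular linear hypermap on the sphere.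

module _ (G : FinGroup) where
  open FinGroup G
  open FinGroupFacts G
  open Powers G
  open Group group using (identityˡ)
  open import Algebra.Properties.Group group using (∙-cancelˡ; ∙-cancelʳ)
  open ≡-Reasoning

  ⟨involution⟩ : ∀ {s x} → s ∙ s ≡ ε → ⟨_⟩ G (s ∷ []) x → x ≡ ε ⊎ x ≡ s
  ⟨involution⟩ s² gen-ε = inj₁ refl
  ⟨involution⟩ {s} s² (gen-∙ p (here refl)) with ⟨involution⟩ s² p
  ... | inj₁ refl = inj₂ (identityˡ s)
  ... | inj₂ refl = inj₁ s²
  ⟨involution⟩ {s} s² (gen-∙⁻¹ p (here refl)) rewrite involution⇒⁻¹ s² with ⟨involution⟩ s² p
  ... | inj₁ refl = inj₂ (identityˡ s)
  ... | inj₂ refl = inj₁ s²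

  product-order≥2 : ∀ {s t k} → t ∙ t ≡ ε → s ≢ t → HasOrder G (s ∙ t) k → 2 ≤ k
  product-order≥2 {s} {t} {1} t² s≢t (_ , st≡ε , _) =
    contradiction (∙-cancelʳ t s t (trans (trans (sym (↑-1 _)) st≡ε) (sym t²))) s≢t
  product-order≥2 {k = suc (suc _)} _ _ _ = s≤s (s≤s z≤n)

  module _ {r₀ r₁ r₂ : Carrier} (hypermap : IsRegularLinearHypermap G r₀ r₁ r₂) where
    private
      r₀-inv = proj₁ hypermap
      r₁-inv = proj₁ (proj₂ hypermap)
      r₂-inv = proj₁ (proj₂ (proj₂ hypermap))
      rest = proj₂ (proj₂ (proj₂ hypermap))
      r₀≢r₁ = proj₁ rest
      r₀≢r₂ = proj₁ (proj₂ rest)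
      r₁≢r₂ = proj₁ (proj₂ (proj₂ rest))
      meet   = proj₁ (proj₂ (proj₂ (proj₂ (proj₂ rest))))
      linear = proj₂ (proj₂ (proj₂ (proj₂ (proj₂ rest))))

    -- If r₀ and r₁ commuted, r₁r₀ would lie in both products of condition (2) but in neither factor.
    linear⇒face-order≥3 : ∀ {n} → HasOrder G (r₀ ∙ r₁) n → 3 ≤ n
    linear⇒face-order≥3 {1} ord with product-order≥2 (proj₁ r₁-inv) r₀≢r₁ ord
    ... | s≤s ()
    linear⇒face-order≥3 {suc (suc (suc _))} _ = s≤s (s≤s (s≤s z≤n))
    linear⇒face-order≥3 {2} (_ , z² , _) = ⊥-elim absurd
      where
      A = ⟨_⟩ G (r₁ ∷ r₂ ∷ [])
      B = ⟨_⟩ G (r₀ ∷ r₂ ∷ [])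
      r₁r₀≡r₀r₁ : r₁ ∙ r₀ ≡ r₀ ∙ r₁
      r₁r₀≡r₀r₁ = ∙-cancelˡ (r₀ ∙ r₁) _ _ (begin
        r₀ ∙ r₁ ∙ (r₁ ∙ r₀)  ≡⟨ TwoInvolutions.z⁻¹ (proj₁ r₀-inv) (proj₁ r₁-inv) ⟩
        ε                    ≡⟨ z² ⟨
        (r₀ ∙ r₁) ↑ 2        ≡⟨ cong ((r₀ ∙ r₁) ∙_) (↑-1 _) ⟩
        r₀ ∙ r₁ ∙ (r₀ ∙ r₁) ∎)
      r₁∈A : A r₁
      r₁∈A = generator (here refl)
      r₀∈B : B r₀
      r₀∈B = generator (here refl)
      excluded : ∀ {x} → x ≢ ε → x ≢ r₂ → A x → B x → ⊥
      excluded {x} x≢ε x≢r₂ a b with ⟨involution⟩ (proj₁ r₂-inv) (proj₁ (meet x) (a , b))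
      ... | inj₁ eq = x≢ε eq
      ... | inj₂ eq = x≢r₂ eq
      absurd : ⊥
      absurd with proj₁ (linear (r₁ ∙ r₀)) ((r₁ , r₀ , r₁∈A , r₀∈B , refl) , (r₀ , r₁ , r₀∈B , r₁∈A , r₁r₀≡r₀r₁))
      -- Cancelling one generator from r₁r₀ would put r₀ or r₁ into both subgroups, hence into ⟨r₂⟩
      -- = {1, r₂} by condition (1).
      ... | inj₁ a = excluded (proj₂ r₀-inv) r₀≢r₂
        (subst A (trans (cong (_∙ r₁) r₁r₀≡r₀r₁) (cancel-involution (proj₁ r₁-inv) r₀)) (gen-∙ a (here refl))) r₀∈B
      ... | inj₂ b = excluded (proj₂ r₁-inv) r₁≢r₂ r₁∈A
        (subst B (cancel-involution (proj₁ r₀-inv) r₁) (gen-∙ b (here refl)))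

    type-spherical : OnSphere G r₀ r₁ r₂ →
      ∃ λ k → ∃ λ m → ∃ λ n → ∃ λ V → ∃ λ E → ∃ λ F → ∃ λ N →
        Spherical k m n V E F N × HasMSeq G r₀ r₁ r₂ k m n V E F N
    type-spherical (_ , V , E , F , counts@((a , size-a , Va) , (b , size-b , Eb) , (c , size-c , Fc)) , euler)
      with k , ordₖ ← hasOrder (r₁ ∙ r₂)
      with m , ordₘ ← hasOrder (r₀ ∙ r₂)
      with n , ordₙ ← hasOrder (r₀ ∙ r₁) =
      k , m , n , V , E , F , order ,
      spherical k m n V E F
        (product-order≥2 (proj₁ r₂-inv) r₁≢r₂ ordₖ) (product-order≥2 (proj₁ r₂-inv) r₀≢r₂ ordₘ)
        (linear⇒face-order≥3 ordₙ)
        (divide V Va (HasSize-unique size-a (dihedral r₁-inv r₂-inv ordₖ)))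
        (divide E Eb (HasSize-unique size-b (dihedral r₀-inv r₂-inv ordₘ)))
        (divide F Fc (HasSize-unique size-c (dihedral r₀-inv r₁-inv ordₙ)))
        -- Genus 0 leaves a summand `4 * 0` in Euler's formula.
        (trans (sym (ℕₚ.+-identityʳ _)) euler) ,
      ordₖ , ordₘ , ordₙ , counts , refl
      where
      dihedral : ∀ {s t e} → IsInvolution G s → IsInvolution G t → HasOrder G (s ∙ t) e →
        HasSize G (⟨_⟩ G (s ∷ t ∷ [])) (2 * e)
      dihedral (s² , s≢ε) (t² , t≢ε) = TwoInvolutions.dihedral-size s² t² s≢ε t≢ε
      divide : ∀ X {a a′} → X * a ≡ order → a ≡ a′ → X * a′ ≡ order
      divide X eq refl = eq

-- The eleven cases.

|A₅×C₂|≡120 : length (permFlags×C₂ 5 isEvenPerm) ≡ 120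
-- Evaluation filters all 5⁵ vectors of images for even permutations.
|A₅×C₂|≡120 = refl

|S₄|≡24 : length (permFlags 4 isPerm) ≡ 24
|S₄|≡24 = refl

|S₄×C₂|≡48 : length (permFlags×C₂ 4 isPerm) ≡ 48
|S₄×C₂|≡48 = refl

module _ (G : FinGroup) (r₀ r₁ r₂ : FinGroup.Carrier G) (hypermap : IsRegularLinearHypermap G r₀ r₁ r₂) where
  open RegularHypermap G r₀ r₁ r₂ (proj₁ hypermap) (proj₁ (proj₂ hypermap)) (proj₁ (proj₂ (proj₂ hypermap)))
    (proj₁ (proj₂ (proj₂ (proj₂ (proj₂ (proj₂ (proj₂ hypermap)))))))

  icosahedron₁-≅ : HasMSeq G r₀ r₁ r₂ 2 5 3 30 12 20 120 →
    𝓜 G r₀ r₁ r₂ ≅ M[G₁] (τ 1 2 · τ 3 5 , true) (τ 1 2 · τ 3 4 , true) (τ 1 3 · τ 2 4 , true)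
  icosahedron₁-≅ (ordₖ , ordₘ , ordₙ , _ , size) =
    permMap×C₂-≅ ordₖ ordₘ ordₙ (τ 1 2 · τ 3 5 , true) (τ 1 2 · τ 3 4 , true) (τ 1 3 · τ 2 4 , true)
      -- Type checking this `tt` runs the search and certifies every edge at the 120 flags.
      (trans size (sym |A₅×C₂|≡120)) tt

  icosahedron₂-≅ : HasMSeq G r₀ r₁ r₂ 2 3 5 30 20 12 120 →
    𝓜 G r₀ r₁ r₂ ≅ M[G₁] (τ 1 2 · τ 3 5 , true) (τ 1 3 · τ 2 4 , true) (τ 1 2 · τ 3 4 , true)
  icosahedron₂-≅ (ordₖ , ordₘ , ordₙ , _ , size) =
    permMap×C₂-≅ ordₖ ordₘ ordₙ (τ 1 2 · τ 3 5 , true) (τ 1 3 · τ 2 4 , true) (τ 1 2 · τ 3 4 , true)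
      (trans size (sym |A₅×C₂|≡120)) tt

  icosahedron₃-≅ : HasMSeq G r₀ r₁ r₂ 3 2 5 20 30 12 120 →
    𝓜 G r₀ r₁ r₂ ≅ M[G₁] (τ 1 4 · τ 3 5 , true) (τ 1 2 · τ 4 5 , true) (τ 1 3 · τ 4 5 , true)
  icosahedron₃-≅ (ordₖ , ordₘ , ordₙ , _ , size) =
    permMap×C₂-≅ ordₖ ordₘ ordₙ (τ 1 4 · τ 3 5 , true) (τ 1 2 · τ 4 5 , true) (τ 1 3 · τ 4 5 , true)
      (trans size (sym |A₅×C₂|≡120)) tt

  icosahedron₄-≅ : HasMSeq G r₀ r₁ r₂ 5 2 3 12 30 20 120 →
    𝓜 G r₀ r₁ r₂ ≅ M[G₁] (τ 1 4 · τ 3 5 , true) (τ 1 4 · τ 2 3 , true) (τ 1 3 · τ 4 5 , true)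
  icosahedron₄-≅ (ordₖ , ordₘ , ordₙ , _ , size) =
    permMap×C₂-≅ ordₖ ordₘ ordₙ (τ 1 4 · τ 3 5 , true) (τ 1 4 · τ 2 3 , true) (τ 1 3 · τ 4 5 , true)
      (trans size (sym |A₅×C₂|≡120)) tt

  tetrahedron₁-≅ : HasMSeq G r₀ r₁ r₂ 2 3 3 6 4 4 24 →
    𝓜 G r₀ r₁ r₂ ≅ M[G₂] (τ 1 3) (τ 1 2) (τ 3 4)
  tetrahedron₁-≅ (ordₖ , ordₘ , ordₙ , _ , size) =
    permMap-≅ ordₖ ordₘ ordₙ (τ 1 3) (τ 1 2) (τ 3 4)
      (trans size (sym |S₄|≡24)) tt

  tetrahedron₂-≅ : HasMSeq G r₀ r₁ r₂ 3 2 3 4 6 4 24 →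
    𝓜 G r₀ r₁ r₂ ≅ M[G₂] (τ 3 4) (τ 1 3) (τ 1 2)
  tetrahedron₂-≅ (ordₖ , ordₘ , ordₙ , _ , size) =
    permMap-≅ ordₖ ordₘ ordₙ (τ 3 4) (τ 1 3) (τ 1 2)
      (trans size (sym |S₄|≡24)) tt

  octahedron₁-≅ : HasMSeq G r₀ r₁ r₂ 2 4 3 12 6 8 48 →
    𝓜 G r₀ r₁ r₂ ≅ M[G₃] (τ 1 3 , false) (τ 3 4 , false) (τ 1 2 · τ 3 4 , true)
  octahedron₁-≅ (ordₖ , ordₘ , ordₙ , _ , size) =
    permMap×C₂-≅ ordₖ ordₘ ordₙ (τ 1 3 , false) (τ 3 4 , false) (τ 1 2 · τ 3 4 , true)
      (trans size (sym |S₄×C₂|≡48)) tt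

  octahedron₂-≅ : HasMSeq G r₀ r₁ r₂ 2 3 4 12 8 6 48 →
    𝓜 G r₀ r₁ r₂ ≅ M[G₃] (τ 1 3 , false) (τ 1 2 · τ 3 4 , true) (τ 3 4 , false)
  octahedron₂-≅ (ordₖ , ordₘ , ordₙ , _ , size) =
    permMap×C₂-≅ ordₖ ordₘ ordₙ (τ 1 3 , false) (τ 1 2 · τ 3 4 , true) (τ 3 4 , false)
      (trans size (sym |S₄×C₂|≡48)) tt

  octahedron₃-≅ : HasMSeq G r₀ r₁ r₂ 3 2 4 8 12 6 48 →
    𝓜 G r₀ r₁ r₂ ≅ M[G₃] (τ 1 2 · τ 3 4 , true) (τ 1 3 , false) (τ 1 2 , false)
  octahedron₃-≅ (ordₖ , ordₘ , ordₙ , _ , size) =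
    permMap×C₂-≅ ordₖ ordₘ ordₙ (τ 1 2 · τ 3 4 , true) (τ 1 3 , false) (τ 1 2 , false)
      (trans size (sym |S₄×C₂|≡48)) tt

  octahedron₄-≅ : HasMSeq G r₀ r₁ r₂ 4 2 3 6 12 8 48 →
    𝓜 G r₀ r₁ r₂ ≅ M[G₃] (τ 1 3 , true) (τ 1 2 , true) (τ 1 3 · τ 2 4 , true)
  octahedron₄-≅ (ordₖ , ordₘ , ordₙ , _ , size) =
    permMap×C₂-≅ ordₖ ordₘ ordₙ (τ 1 3 , true) (τ 1 2 , true) (τ 1 3 · τ 2 4 , true)
      (trans size (sym |S₄×C₂|≡48)) tt

  hosohedral-≅ : (Σ ℕ λ n → 3 ≤ n × HasMSeq G r₀ r₁ r₂ 2 2 n n n 2 (4 * n)) →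
    Σ ℕ λ n → 3 ≤ n × 𝓜 G r₀ r₁ r₂ ≅ M[G₄] n × HasMSeq G r₀ r₁ r₂ 2 2 n n n 2 (4 * n)
  hosohedral-≅ (n , 3≤n , mseq@(ordₖ , ordₘ , ordₙ , _ , size)) = n , 3≤n , hosohedron-≅ ordₖ ordₘ ordₙ size , mseq

  -- Turns the table into a nested sum of the theorem's shape, to which the isomorphisms are then
  -- added summand by summand.
  M-sequences : (∃ λ k → ∃ λ m → ∃ λ n → ∃ λ V → ∃ λ E → ∃ λ F → ∃ λ N →
      Spherical k m n V E F N × HasMSeq G r₀ r₁ r₂ k m n V E F N) →
      HasMSeq G r₀ r₁ r₂ 2 5 3 30 12 20 120
    ⊎ HasMSeq G r₀ r₁ r₂ 2 3 5 30 20 12 120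
    ⊎ HasMSeq G r₀ r₁ r₂ 3 2 5 20 30 12 120
    ⊎ HasMSeq G r₀ r₁ r₂ 5 2 3 12 30 20 120
    ⊎ HasMSeq G r₀ r₁ r₂ 2 3 3 6 4 4 24
    ⊎ HasMSeq G r₀ r₁ r₂ 3 2 3 4 6 4 24
    ⊎ HasMSeq G r₀ r₁ r₂ 2 4 3 12 6 8 48
    ⊎ HasMSeq G r₀ r₁ r₂ 2 3 4 12 8 6 48
    ⊎ HasMSeq G r₀ r₁ r₂ 3 2 4 8 12 6 48
    ⊎ HasMSeq G r₀ r₁ r₂ 4 2 3 6 12 8 48
    ⊎ (Σ ℕ λ n → 3 ≤ n × HasMSeq G r₀ r₁ r₂ 2 2 n n n 2 (4 * n))
  M-sequences (_ , _ , _ , _ , _ , _ , _ , icosahedron₁ , mseq) = inj₁ mseq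
  M-sequences (_ , _ , _ , _ , _ , _ , _ , icosahedron₂ , mseq) = inj₂ (inj₁ mseq)
  M-sequences (_ , _ , _ , _ , _ , _ , _ , icosahedron₃ , mseq) = inj₂ (inj₂ (inj₁ mseq))
  M-sequences (_ , _ , _ , _ , _ , _ , _ , icosahedron₄ , mseq) = inj₂ (inj₂ (inj₂ (inj₁ mseq)))
  M-sequences (_ , _ , _ , _ , _ , _ , _ , tetrahedron₁ , mseq) = inj₂ (inj₂ (inj₂ (inj₂ (inj₁ mseq))))
  M-sequences (_ , _ , _ , _ , _ , _ , _ , tetrahedron₂ , mseq) = inj₂ (inj₂ (inj₂ (inj₂ (inj₂ (inj₁ mseq)))))
  M-sequences (_ , _ , _ , _ , _ , _ , _ , octahedron₁ , mseq) = inj₂ (inj₂ (inj₂ (inj₂ (inj₂ (inj₂ (inj₁ mseq))))))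
  M-sequences (_ , _ , _ , _ , _ , _ , _ , octahedron₂ , mseq) = inj₂ (inj₂ (inj₂ (inj₂ (inj₂ (inj₂ (inj₂ (inj₁ mseq)))))))
  M-sequences (_ , _ , _ , _ , _ , _ , _ , octahedron₃ , mseq) = inj₂ (inj₂ (inj₂ (inj₂ (inj₂ (inj₂ (inj₂ (inj₂ (inj₁ mseq))))))))
  M-sequences (_ , _ , _ , _ , _ , _ , _ , octahedron₄ , mseq) = inj₂ (inj₂ (inj₂ (inj₂ (inj₂ (inj₂ (inj₂ (inj₂ (inj₂ (inj₁ mseq)))))))))
  M-sequences (_ , _ , n , _ , _ , _ , _ , hosohedron .n 3≤n , mseq) = inj₂ (inj₂ (inj₂ (inj₂ (inj₂ (inj₂ (inj₂ (inj₂ (inj₂ (inj₂ (n , 3≤n , mseq))))))))))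

theorem4p13 : (G : FinGroup) (r₀ r₁ r₂ : FinGroup.Carrier G) →
    IsRegularLinearHypermap G r₀ r₁ r₂ → OnSphere G r₀ r₁ r₂ →
    (𝓜 G r₀ r₁ r₂ ≅ M[G₁] (τ 1 2 · τ 3 5 , true) (τ 1 2 · τ 3 4 , true) (τ 1 3 · τ 2 4 , true)
    × HasMSeq G r₀ r₁ r₂ 2 5 3 30 12 20 120)
    ⊎ (𝓜 G r₀ r₁ r₂ ≅ M[G₁] (τ 1 2 · τ 3 5 , true) (τ 1 3 · τ 2 4 , true) (τ 1 2 · τ 3 4 , true)
    × HasMSeq G r₀ r₁ r₂ 2 3 5 30 20 12 120)
    ⊎ (𝓜 G r₀ r₁ r₂ ≅ M[G₁] (τ 1 4 · τ 3 5 , true) (τ 1 2 · τ 4 5 , true) (τ 1 3 · τ 4 5 , true)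
    × HasMSeq G r₀ r₁ r₂ 3 2 5 20 30 12 120)
    ⊎ (𝓜 G r₀ r₁ r₂ ≅ M[G₁] (τ 1 4 · τ 3 5 , true) (τ 1 4 · τ 2 3 , true) (τ 1 3 · τ 4 5 , true)
    × HasMSeq G r₀ r₁ r₂ 5 2 3 12 30 20 120)
    ⊎ (𝓜 G r₀ r₁ r₂ ≅ M[G₂] (τ 1 3) (τ 1 2) (τ 3 4)
    × HasMSeq G r₀ r₁ r₂ 2 3 3 6 4 4 24)
    ⊎ (𝓜 G r₀ r₁ r₂ ≅ M[G₂] (τ 3 4) (τ 1 3) (τ 1 2)
    × HasMSeq G r₀ r₁ r₂ 3 2 3 4 6 4 24)
    ⊎ (𝓜 G r₀ r₁ r₂ ≅ M[G₃] (τ 1 3 , false) (τ 3 4 , false) (τ 1 2 · τ 3 4 , true)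
    × HasMSeq G r₀ r₁ r₂ 2 4 3 12 6 8 48)
    ⊎ (𝓜 G r₀ r₁ r₂ ≅ M[G₃] (τ 1 3 , false) (τ 1 2 · τ 3 4 , true) (τ 3 4 , false)
    × HasMSeq G r₀ r₁ r₂ 2 3 4 12 8 6 48)
    ⊎ (𝓜 G r₀ r₁ r₂ ≅ M[G₃] (τ 1 2 · τ 3 4 , true) (τ 1 3 , false) (τ 1 2 , false)
    × HasMSeq G r₀ r₁ r₂ 3 2 4 8 12 6 48)
    ⊎ (𝓜 G r₀ r₁ r₂ ≅ M[G₃] (τ 1 3 , true) (τ 1 2 , true) (τ 1 3 · τ 2 4 , true)
    × HasMSeq G r₀ r₁ r₂ 4 2 3 6 12 8 48)
    ⊎ (Σ ℕ λ n → 3 ≤ n × 𝓜 G r₀ r₁ r₂ ≅ M[G₄] n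
    × HasMSeq G r₀ r₁ r₂ 2 2 n n n 2 (4 * n))
theorem4p13 G r₀ r₁ r₂ hypermap sphere =
  Sum.map < icosahedron₁-≅ G r₀ r₁ r₂ hypermap , id > (
  Sum.map < icosahedron₂-≅ G r₀ r₁ r₂ hypermap , id > (
  Sum.map < icosahedron₃-≅ G r₀ r₁ r₂ hypermap , id > (
  Sum.map < icosahedron₄-≅ G r₀ r₁ r₂ hypermap , id > (
  Sum.map < tetrahedron₁-≅ G r₀ r₁ r₂ hypermap , id > (
  Sum.map < tetrahedron₂-≅ G r₀ r₁ r₂ hypermap , id > (
  Sum.map < octahedron₁-≅ G r₀ r₁ r₂ hypermap , id > (
  Sum.map < octahedron₂-≅ G r₀ r₁ r₂ hypermap , id > (
  Sum.map < octahedron₃-≅ G r₀ r₁ r₂ hypermap , id > (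
  Sum.map < octahedron₄-≅ G r₀ r₁ r₂ hypermap , id > (
  hosohedral-≅ G r₀ r₁ r₂ hypermap)))))))))) (M-sequences G r₀ r₁ r₂ hypermap (type-spherical G hypermap sphere))
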